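{- Let $p=4$ or $p=6$. For every $p$-angulation $D$ of a polygon $P$, there exist exactly two triangulations $T_D^{\circ}$ and $T_D^{\bullet}$ of $P$ such that the frieze of type $\Lambda_p$ associated to $D$ and the Conway--Coxeter frieze of $T_D^{\circ}$ coincide in every second row, and likewise the frieze of type $\Lambda_p$ associated to $D$ and the Conway--Coxeter frieze of $T_D^{\bullet}$ coincide in every second row. (That is, there are exactly two triangulations $T$ of $P$ whose Conway--Coxeter frieze coincides in every second row with the frieze of type $\Lambda_p$ associated to $D$.)
   Context: A frieze of width $n$ is an array of real numbers $(m_{i,j})$, indexed by $i\in\mathbb{Z}$ and $j$ with $-2\le j-i\le n+1$, such that $m_{i,i-2}=m_{i,i+n+1}=0$, $m_{i,i-1}=m_{i,i+n}=1$, the remaining entries are positive, and the unimodular rule $m_{i,i+r}m_{i+1,i+r+1}-m_{i+1,i+r}m_{i,i+r+1}=1$ holds for all $i\in\mathbb{Z}$ and $-1\le r\le n$. The $r$-th row is $(m_{i,i+r})_{i\in\mathbb{Z}}$; the row $r=0$ is called the quiddity row. The quiddity row determines the frieze via $m_{i,i+r}=m_{i,i}m_{i+1,i+r}-m_{i+2,i+r}$. A $p$-angulation $D$ of a convex regular polygon $P$ is a set of non-intersecting diagonals partitioning $P$ into a finite collection of $p$-gons (a triangulation is the case $p=3$). Let $P$ have $n+3$ vertices, labelled $0,1,\dots,n+2$ in cyclic order. For a vertex $\alpha$, let $q_\alpha$ be the number of $p$-gons of $D$ incident with $\alpha$, and let $\lambda_p=2\cos(\pi/p)$. The frieze of type $\Lambda_p$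 associated to $D$ is the frieze of width $n$ with $m_{i,i}=\lambda_p q_{i \bmod (n+3)}$ for all $i\in\mathbb{Z}$ (it is known that such a frieze exists and is unique). For $p=3$, $\lambda_3=1$, and the frieze so associated to a triangulation $T$ of $P$ is called the Conway--Coxeter frieze of $T$; its entries in the rows $-1\le r\le n$ are positive integers. Two friezes $(m_{i,j})$ and $(m'_{i,j})$ of width $n$ coincide in every second row if $m_{i,i+r}=m'_{i,i+r}$ for all $i\in\mathbb{Z}$ and all odd $r$ with $-1\le r\le n+1$. -}

module Defs where

open import Level using (Level; _⊔_; 0ℓ) renaming (suc to lsuc)
open import Algebra.Apartness.Bundles using (HeytingField; HeytingCommutativeRing)
open import Algebra.Bundles using (CommutativeRing)
open import Data.Fin.Base as Fin using (Fin; toℕ; fromℕ<)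
import Data.Fin.Properties as Fin
open import Data.Fin.Subset using (Subset; inside; outside; _∈_; ∣_∣)
open import Data.Fin.Subset.Properties using (_∈?_)
open import Data.Integer.Base as ℤ using (ℤ; +_)
open import Data.Integer.DivMod using (_%ℕ_; n%ℕd<d)
open import Data.List.Base using (List; []; _∷_; map; _++_; filter; length)
open import Data.Nat.Base as ℕ using (ℕ; zero; suc; NonZero)
import Data.Nat.Properties as ℕ
open import Data.Product using (_×_; _,_; ∃-syntax; proj₁; proj₂)
open import Data.Sum using (_⊎_; inj₁; inj₂)
import Data.Vec.Base as Vec
open import Function.Bundles using (_⇔_)
open import Relation.Binary.Core using (Rel)
open import Relation.Binary.Definitions using (Decidable)
open import Relation.Binary.PropositionalEquality using (_≡_)
open import Relation.Binary.Structures using (IsStrictPartialOrder)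
open import Relation.Nullary.Decidable using (Dec; ¬?; _×-dec_; _⊎-dec_; _→-dec_)
open import Relation.Nullary.Negation using (¬_)
import Algebra.Properties.Monoid.Mult
import Algebra.Properties.Ring

------------------------------------------------------------------------
-- Real numbers

-- Cauchy complete archimedean ordered fields.  These determine ℝ up to
-- isomorphism; the axioms are those satisfied constructively by the
-- Cauchy reals, and classically they are the usual ones.

record RealNumbers c ℓ₁ ℓ₂ : Set (lsuc (c ⊔ ℓ₁ ⊔ ℓ₂)) where
  infix 4 _<_
  field
    heytingField : HeytingField c ℓ₁ ℓ₂

  open HeytingField heytingField public
    using ( Carrier; _≈_; _#_; _+_; _*_; -_; _-_; 0#; 1#; heytingCommutativeRing
          ; #-sym; #⇒invertible; invertible⇒#; tight )

  open HeytingCommutativeRing heytingCommutativeRing public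
    using (commutativeRing)

  open Algebra.Properties.Monoid.Mult
    (CommutativeRing.+-monoid commutativeRing) using () renaming (_×_ to _·_)

  fromℕ : ℕ → Carrier
  fromℕ n = n · 1#

  field
    _<_                  : Rel Carrier ℓ₂
    isStrictPartialOrder : IsStrictPartialOrder _≈_ _<_
    #⇒<⊎>                : ∀ {x y} → x # y → x < y ⊎ y < x
    <⇒#                  : ∀ {x y} → x < y → x # y
    +-monoˡ-<            : ∀ z {x y} → x < y → x + z < y + z
    *-positive           : ∀ {x y} → 0# < x → 0# < y → 0# < x * y

  IsCauchy : (ℕ → Carrier) → Set (c ⊔ ℓ₂)
  IsCauchy s = ∀ ε → 0# < ε → ∃[ N ] ∀ k l → N ℕ.≤ k → N ℕ.≤ l → s k < s l + ε

  ConvergesTo : (ℕ → Carrier) → Carrier → Set (c ⊔ ℓ₂)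
  ConvergesTo s x =
    ∀ ε → 0# < ε → ∃[ N ] ∀ k → N ℕ.≤ k → s k < x + ε × x < s k + ε

  field
    archimedean : ∀ x → ∃[ n ] x < fromℕ n
    complete    : ∀ s → IsCauchy s → ∃[ x ] ConvergesTo s x

  private
    module R  = CommutativeRing commutativeRing
    module RP = Algebra.Properties.Ring R.ring
    module SPO = IsStrictPartialOrder isStrictPartialOrder

    <-resp : ∀ {x x′ y y′} → x ≈ x′ → y ≈ y′ → x < y → x′ < y′
    <-resp p q x<y = SPO.<-respˡ-≈ p (SPO.<-respʳ-≈ q x<y)

  0<1 : 0# < 1#
  0<1 with #⇒<⊎> (invertible⇒# {1#} {0#}
             (1# , R.trans (R.*-identityˡ _) 1-0 , R.trans (R.*-identityʳ _) 1-0))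
    where
    1-0 : 1# - 0# ≈ 1#
    1-0 = R.trans (R.+-congˡ RP.-0#≈0#) (R.+-identityʳ 1#)
  ... | inj₂ 0<1′ = 0<1′
  ... | inj₁ 1<0  = <-resp R.refl -1*-1≈1 (*-positive 0<-1 0<-1)
    where
    0<-1 : 0# < - 1#
    0<-1 = <-resp (R.-‿inverseʳ 1#) (R.+-identityˡ (- 1#)) (+-monoˡ-< (- 1#) 1<0)
    -1*-1≈1 : - 1# * - 1# ≈ 1#
    -1*-1≈1 = R.trans (RP.-1*x≈-x (- 1#)) (RP.-‿involutive 1#)

  fromℕ-positive : ∀ n → 0# < fromℕ (suc n)
  fromℕ-positive zero    = <-resp R.refl (R.sym (R.+-identityʳ 1#)) 0<1
  fromℕ-positive (suc n) =
    SPO.trans (fromℕ-positive n)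
      (<-resp (R.+-identityˡ _) R.refl (+-monoˡ-< (fromℕ (suc n)) 0<1))

  fromℕ-invertible : ∀ n .{{_ : NonZero n}} → ∃[ y ] fromℕ n * y ≈ 1#
  fromℕ-invertible (suc n) =
    let y , _ , xy≈1 = #⇒invertible (#-sym (<⇒# (fromℕ-positive n)))
    in  y , R.trans (R.*-congʳ (R.sym x-0≈x)) xy≈1
    where
    x-0≈x : fromℕ (suc n) - 0# ≈ fromℕ (suc n)
    x-0≈x = R.trans (R.+-congˡ RP.-0#≈0#) (R.+-identityʳ _)

  infixl 7 _/_
  _/_ : Carrier → (n : ℕ) .{{_ : NonZero n}} → Carrier
  x / n = x * proj₁ (fromℕ-invertible n)

-- The functions cos and sin and the number π.  By the addition formulas
-- and the Pythagorean identity, x ↦ cos x + i sin x is a homomorphism to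
-- the unit circle; the bounds on sin make it continuous with derivative
-- i at 0, so that it is x ↦ exp (i x); and π / 2 is the first positive
-- zero of cos.

record Trigonometry {c ℓ₁ ℓ₂} (ℝ : RealNumbers c ℓ₁ ℓ₂) : Set (c ⊔ ℓ₁ ⊔ ℓ₂) where
  open RealNumbers ℝ
  field
    cos sin    : Carrier → Carrier
    π          : Carrier
    cos-cong   : ∀ {x y} → x ≈ y → cos x ≈ cos y
    sin-cong   : ∀ {x y} → x ≈ y → sin x ≈ sin y
    cos-+      : ∀ x y → cos (x + y) ≈ cos x * cos y - sin x * sin y
    sin-+      : ∀ x y → sin (x + y) ≈ sin x * cos y + cos x * sin y
    pythagoras : ∀ x → cos x * cos x + sin x * sin x ≈ 1#
    0<π        : 0# < π
    cos-π/2    : cos (π / 2) ≈ 0#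
    cos>0      : ∀ x → 0# < x → x < π / 2 → 0# < cos x
    sin<x      : ∀ x → 0# < x → x < π / 2 → sin x < x
    xcos<sin   : ∀ x → 0# < x → x < π / 2 → x * cos x < sin x

------------------------------------------------------------------------
-- Polygons

-- The vertices of an N-gon are the elements of Fin N, in cyclic order.
-- A segment joining two vertices is written with the smaller one first.

IsEdge : ∀ {N} → Rel (Fin N) 0ℓ
IsEdge {N} a b =
  toℕ b ≡ suc (toℕ a) ⊎ (toℕ a ≡ 0 × suc (toℕ b) ≡ N)

isEdge? : ∀ {N} → Decidable (IsEdge {N})
isEdge? {N} a b =
  (toℕ b ℕ.≟ suc (toℕ a)) ⊎-dec ((toℕ a ℕ.≟ 0) ×-dec (suc (toℕ b) ℕ.≟ N))

IsDiagonal : ∀ {N} → Rel (Fin N) 0ℓ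
IsDiagonal a b = a Fin.< b × ¬ IsEdge a b

-- Sets of pairwise non-crossing diagonals of the N-gon.

record Dissection (N : ℕ) : Set₁ where
  field
    Diag        : Rel (Fin N) 0ℓ
    diag?       : Decidable Diag
    diagonal    : ∀ {a b} → Diag a b → IsDiagonal a b
    noncrossing : ∀ {a b c d} → Diag a c → Diag b d →
                  ¬ (a Fin.< b × b Fin.< c × c Fin.< d)

open Dissection public

infix 4 _≐_
_≐_ : ∀ {N} → Rel (Dissection N) 0ℓ
D ≐ D′ = ∀ a b → Diag D a b ⇔ Diag D′ a b

-- For vertices a < b in S: a and b are neighbours in the cyclic order
-- of S, that is, they span a side of the convex hull of S.

IsSide : ∀ {N} → Subset N → Rel (Fin N) 0ℓ
IsSide S a b = (∀ c → c ∈ S → ¬ (a Fin.< c × c Fin.< b))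
             ⊎ (∀ c → c ∈ S → a Fin.≤ c × c Fin.≤ b)

Joined : ∀ {N} → Dissection N → Rel (Fin N) 0ℓ
Joined D a b = IsEdge a b ⊎ Diag D a b

-- S is the vertex set of one of the polygons into which D cuts the
-- N-gon: every side of the convex hull of S is an edge or belongs to D,
-- and no segment of D runs between two non-neighbouring vertices of S.

IsCell : ∀ {N} → Dissection N → Subset N → Set
IsCell D S =
  3 ℕ.≤ ∣ S ∣ ×
  (∀ a → a ∈ S → ∀ b → b ∈ S → a Fin.< b →
    (IsSide S a b → Joined D a b) × (Joined D a b → IsSide S a b))

isSide? : ∀ {N} (S : Subset N) → Decidable (IsSide S)
isSide? S a b =
  Fin.all? (λ c → (c ∈? S) →-dec ¬? ((a Fin.<? c) ×-dec (c Fin.<? b)))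
  ⊎-dec
  Fin.all? (λ c → (c ∈? S) →-dec ((a Fin.≤? c) ×-dec (c Fin.≤? b)))

isCell? : ∀ {N} (D : Dissection N) (S : Subset N) → Dec (IsCell D S)
isCell? D S = (3 ℕ.≤? ∣ S ∣) ×-dec
  Fin.all? λ a → (a ∈? S) →-dec Fin.all? λ b → (b ∈? S) →-dec (a Fin.<? b) →-dec
    ((isSide? S a b →-dec joined? a b) ×-dec (joined? a b →-dec isSide? S a b))
  where
  joined? : Decidable (Joined D)
  joined? a b = isEdge? a b ⊎-dec diag? D a b

record Angulation (p N : ℕ) : Set₁ where
  field
    dissection : Dissection N
    cells      : ∀ S → IsCell dissection S → ∣ S ∣ ≡ p

open Angulation public

Triangulation : ℕ → Set₁
Triangulation = Angulation 3

subsets : ∀ N → List (Subset N)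
subsets zero    = Vec.[] ∷ []
subsets (suc N) =
  map (outside Vec.∷_) (subsets N) ++ map (inside Vec.∷_) (subsets N)

-- The number of cells incident with α.

incidence : ∀ {N} → Dissection N → Fin N → ℕ
incidence {N} D α =
  length (filter (λ S → (α ∈? S) ×-dec isCell? D S) (subsets N))

------------------------------------------------------------------------
-- Friezes

infix 6 _mod_
_mod_ : ℤ → (N : ℕ) .{{_ : NonZero N}} → Fin N
i mod N = fromℕ< (n%ℕd<d i N)

IsOdd : ℤ → Set
IsOdd r = ∃[ k ] r ≡ + 2 ℤ.* k ℤ.+ + 1

module Friezes {c ℓ₁ ℓ₂} (ℝ : RealNumbers c ℓ₁ ℓ₂) (trig : Trigonometry ℝ) where
  open RealNumbers ℝ
  open Trigonometry trig

  -- Arrays are total functions of i and j; only the entries with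
  -- -2 ≤ j - i ≤ n + 1 are constrained, and only these matter below.

  Array : Set c
  Array = ℤ → ℤ → Carrier

  record IsFrieze (n : ℕ) (m : Array) : Set (c ⊔ ℓ₁ ⊔ ℓ₂) where
    field
      row₋₂      : ∀ i → m i (i ℤ.- + 2) ≈ 0#
      row₋₁      : ∀ i → m i (i ℤ.- + 1) ≈ 1#
      rowₙ       : ∀ i → m i (i ℤ.+ + n) ≈ 1#
      rowₙ₊₁     : ∀ i → m i (i ℤ.+ + n ℤ.+ + 1) ≈ 0#
      positive   : ∀ i r → + 0 ℤ.≤ r → r ℤ.< + n → 0# < m i (i ℤ.+ r)
      unimodular : ∀ i r → ℤ.- + 1 ℤ.≤ r → r ℤ.≤ + n →
        m i (i ℤ.+ r) * m (i ℤ.+ + 1) (i ℤ.+ r ℤ.+ + 1)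
          - m (i ℤ.+ + 1) (i ℤ.+ r) * m i (i ℤ.+ r ℤ.+ + 1) ≈ 1#

  λ[_] : (p : ℕ) .{{_ : NonZero p}} → Carrier
  λ[ p ] = fromℕ 2 * cos (π / p)

  -- m is the frieze of type Λ_p associated to D.

  record IsFriezeOf {p n} .{{_ : NonZero p}}
                    (D : Angulation p (3 ℕ.+ n)) (m : Array)
                    : Set (c ⊔ ℓ₁ ⊔ ℓ₂) where
    field
      isFrieze : IsFrieze n m
      quiddity : ∀ i →
        m i i ≈ λ[ p ] * fromℕ (incidence (dissection D) (i mod (3 ℕ.+ n)))

  -- The frieze of type Λ₃ associated to T, where λ[ 3 ] ≈ 1.

  IsConwayCoxeterFriezeOf : ∀ {n} → Triangulation (3 ℕ.+ n) → Array → Set (c ⊔ ℓ₁ ⊔ ℓ₂)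
  IsConwayCoxeterFriezeOf T m = IsFriezeOf T m

  CoincideInEverySecondRow : ℕ → Array → Array → Set ℓ₁
  CoincideInEverySecondRow n m m′ =
    ∀ i r → IsOdd r → ℤ.- + 1 ℤ.≤ r → r ℤ.≤ + n ℤ.+ + 1 →
    m i (i ℤ.+ r) ≈ m′ i (i ℤ.+ r)

  CoincidesWithConwayCoxeter : ∀ {n} → Array → Triangulation (3 ℕ.+ n) → Set (c ⊔ ℓ₁ ⊔ ℓ₂)
  CoincidesWithConwayCoxeter {n} m T =
    ∃[ m′ ] IsConwayCoxeterFriezeOf T m′ × CoincideInEverySecondRow n m m′

{-# OPTIONS --safe #-}
module Submission where

-- In a p-angulation with p even every diagonal joins vertices of opposite parity.
-- Joining in every cell the vertices of a fixed parity gives a triangulation whose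
-- quiddity is λ² q at these vertices and q at the others, λ² being 2 or 3. This is
-- the quiddity λ q scaled alternately by λ and λ⁻¹, which leaves every second row
-- of the frieze unchanged. Conversely, row 1 of the frieze determines the products
-- λ² q_i q_{i+1} of neighbouring entries of the quiddity of a triangulation T. Some
-- two neighbouring vertices have q = 1, so there T has quiddity 1 and λ² in some
-- order as λ² is prime; hence the quiddity of T is one of the two above, and it
-- determines T.

open import Defs
open import Algebra.Bundles using (CommutativeRing)
import Algebra.Properties.Ring
import Algebra.Properties.Semiring.Mult
import Algebra.Solver.Ring.NaturalCoefficients.Default
open import Data.Empty using (⊥; ⊥-elim)
open import Data.Fin.Base as Fin using (Fin; toℕ; fromℕ<)
import Data.Fin.Properties as Fin
open import Data.Integer.Base as ℤ using (ℤ; +_; -[1+_])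
open import Data.Integer.DivMod using (_%ℕ_; _/ℕ_; n%ℕd<d; a≡a%ℕn+[a/ℕn]*n)
import Data.Integer.Properties as ℤ
open import Data.Nat.Base as ℕ using (ℕ; zero; suc; NonZero; parity)
open import Data.Nat.DivMod using (m<n⇒m%n≡m)
open import Data.Nat.Primality using (Prime; prime?; prime⇒irreducible; prime⇒nonZero; ¬prime[1])
import Data.Nat.Properties as ℕ
open import Data.Parity.Base as ℙ using (Parity; 0ℙ; 1ℙ; _⁻¹)
import Data.Parity.Properties as ℙ
open import Data.Product using (∃; ∃₂; _×_; _,_; proj₁; proj₂)
open import Data.Sum using (_⊎_; inj₁; inj₂)
open import Level using (0ℓ)
open import Relation.Binary.Core using (Rel)
open import Relation.Binary.Definitions using (Decidable; tri<; tri≈; tri>)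
open import Relation.Binary.PropositionalEquality as ≡ using (_≡_; refl; cong)
import Relation.Binary.Reasoning.Setoid
open import Relation.Binary.Structures using (IsStrictPartialOrder)
open import Relation.Nullary
open import Relation.Nullary.Decidable using (dec-true; dec-false; does-⇔; from-yes)
open import Relation.Unary using (Pred)

-- Incidence numbers are defined by a search through all subsets of the vertices, which offers no
-- induction. A dissection is therefore replaced by the tree of its cells, rooted at the edge from 0
-- to `2 + n`; the segment from x to y has behind it exactly the cells on vertices between x and y,
-- and counts become recursive. The bridge is that a cell is determined by its least and greatest
-- vertex. The cases 4 and 6 are those in which two numbers agree: `λ²`, and the number of triangles
-- at a chosen vertex of a refined cell. Joining alternate vertices of a quadrilateral gives one
-- diagonal, so each chosen vertex lies in 2 triangles; in a hexagon it gives a central triangle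
-- with three ears, so each chosen vertex lies in 3. The remaining vertices lie in one. Neighbouring
-- vertices with q = 1 exist because a cell with only edges behind its sides, apart from the side
-- towards the root, has at least four vertices, hence two consecutive ones away from that side. A
-- triangulation is recovered from its counts bottom-up: two adjacent pieces are closed by a
-- triangle exactly when their common vertex has only one cell beyond those of the pieces.

module NodeSums where

  open import Data.List.Base using ([]; _∷_)
  open import Data.Nat.Base
  open import Data.Nat.Tactic.RingSolver using (solve)
  open import Relation.Binary.PropositionalEquality using (cong₂; module ≡-Reasoning)

  -- The left-hand sides count the triangles refining a cell, and those in the refinements
  -- of its children, at a vertex of weight W; A, B, C, … are the values δ v at the vertices
  -- of the cell.
  module _ (W : ℕ) where

    -- The diagonal joins the first and third vertices, so these lie in both triangles and the other
    -- two in one. The premises say that the weight is 2 or 1 accordingly wherever the indicator of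
    -- the vertex is not zero.
    quad-sum-even : ∀ A B C D x y z → W * A ≡ 2 * A → W * B ≡ B → W * C ≡ 2 * C → W * D ≡ D →
      (A + (C + (D + 0))) + (((A + (B + (C + 0))) + (W * x + W * y)) + W * z) ≡
      W * ((A + (B + (C + (D + 0)))) + (x + (y + z)))
    quad-sum-even A B C D x y z p q r s = begin
      (A + (C + (D + 0))) + (((A + (B + (C + 0))) + (W * x + W * y)) + W * z)
        ≡⟨ solve (W ∷ A ∷ B ∷ C ∷ D ∷ x ∷ y ∷ z ∷ []) ⟩
      (2 * A + B) + (2 * C + D) + W * (x + (y + z))
        ≡⟨ cong (_+ W * (x + (y + z))) (cong₂ _+_ (cong₂ _+_ p q) (cong₂ _+_ r s)) ⟨
      (W * A + W * B) + (W * C + W * D) + W * (x + (y + z))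
        ≡⟨ solve (W ∷ A ∷ B ∷ C ∷ D ∷ x ∷ y ∷ z ∷ []) ⟩
      W * ((A + (B + (C + (D + 0)))) + (x + (y + z))) ∎
      where open ≡-Reasoning

    quad-sum-odd : ∀ A B C D x y z → W * A ≡ A → W * B ≡ 2 * B → W * C ≡ C → W * D ≡ 2 * D →
      (A + (B + (D + 0))) + (W * x + ((B + (C + (D + 0))) + (W * y + W * z))) ≡
      W * ((A + (B + (C + (D + 0)))) + (x + (y + z)))
    quad-sum-odd A B C D x y z p q r s = begin
      (A + (B + (D + 0))) + (W * x + ((B + (C + (D + 0))) + (W * y + W * z)))
        ≡⟨ solve (W ∷ A ∷ B ∷ C ∷ D ∷ x ∷ y ∷ z ∷ []) ⟩
      (A + 2 * B) + (C + 2 * D) + W * (x + (y + z))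
        ≡⟨ cong (_+ W * (x + (y + z))) (cong₂ _+_ (cong₂ _+_ p q) (cong₂ _+_ r s)) ⟨
      (W * A + W * B) + (W * C + W * D) + W * (x + (y + z))
        ≡⟨ solve (W ∷ A ∷ B ∷ C ∷ D ∷ x ∷ y ∷ z ∷ []) ⟩
      W * ((A + (B + (C + (D + 0)))) + (x + (y + z))) ∎
      where open ≡-Reasoning

    -- The central triangle is A C E. Each of its vertices also lies in two of the ears A B C, C D E
    -- and A E F; the ear A E F is outermost because it contains the root side.
    hex-sum-even : ∀ A B C D E F v w x y z →
      W * A ≡ 3 * A → W * B ≡ B → W * C ≡ 3 * C → W * D ≡ D → W * E ≡ 3 * E → W * F ≡ F →
      (A + (E + (F + 0))) + (((A + (C + (E + 0))) + (((A + (B + (C + 0))) + (W * v + W * w))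
        + ((C + (D + (E + 0))) + (W * x + W * y)))) + W * z) ≡
      W * ((A + (B + (C + (D + (E + (F + 0)))))) + (v + (w + (x + (y + z)))))
    hex-sum-even A B C D E F v w x y z p q r s t u = begin
      (A + (E + (F + 0))) + (((A + (C + (E + 0))) + (((A + (B + (C + 0))) + (W * v + W * w))
        + ((C + (D + (E + 0))) + (W * x + W * y)))) + W * z)
        ≡⟨ solve (W ∷ A ∷ B ∷ C ∷ D ∷ E ∷ F ∷ v ∷ w ∷ x ∷ y ∷ z ∷ []) ⟩
      (3 * A + B) + (3 * C + D) + (3 * E + F) + W * (v + (w + (x + (y + z))))
        ≡⟨ cong (_+ W * (v + (w + (x + (y + z)))))
             (cong₂ _+_ (cong₂ _+_ (cong₂ _+_ p q) (cong₂ _+_ r s)) (cong₂ _+_ t u)) ⟨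
      (W * A + W * B) + (W * C + W * D) + (W * E + W * F) + W * (v + (w + (x + (y + z))))
        ≡⟨ solve (W ∷ A ∷ B ∷ C ∷ D ∷ E ∷ F ∷ v ∷ w ∷ x ∷ y ∷ z ∷ []) ⟩
      W * ((A + (B + (C + (D + (E + (F + 0)))))) + (v + (w + (x + (y + z))))) ∎
      where open ≡-Reasoning

    hex-sum-odd : ∀ A B C D E F v w x y z →
      W * A ≡ A → W * B ≡ 3 * B → W * C ≡ C → W * D ≡ 3 * D → W * E ≡ E → W * F ≡ 3 * F →
      (A + (B + (F + 0))) + (W * v + ((B + (D + (F + 0))) + (((B + (C + (D + 0))) + (W * w + W * x))
        + ((D + (E + (F + 0))) + (W * y + W * z))))) ≡
      W * ((A + (B + (C + (D + (E + (F + 0)))))) + (v + (w + (x + (y + z)))))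
    hex-sum-odd A B C D E F v w x y z p q r s t u = begin
      (A + (B + (F + 0))) + (W * v + ((B + (D + (F + 0))) + (((B + (C + (D + 0))) + (W * w + W * x))
        + ((D + (E + (F + 0))) + (W * y + W * z)))))
        ≡⟨ solve (W ∷ A ∷ B ∷ C ∷ D ∷ E ∷ F ∷ v ∷ w ∷ x ∷ y ∷ z ∷ []) ⟩
      (A + 3 * B) + (C + 3 * D) + (E + 3 * F) + W * (v + (w + (x + (y + z))))
        ≡⟨ cong (_+ W * (v + (w + (x + (y + z)))))
             (cong₂ _+_ (cong₂ _+_ (cong₂ _+_ p q) (cong₂ _+_ r s)) (cong₂ _+_ t u)) ⟨
      (W * A + W * B) + (W * C + W * D) + (W * E + W * F) + W * (v + (w + (x + (y + z))))
        ≡⟨ solve (W ∷ A ∷ B ∷ C ∷ D ∷ E ∷ F ∷ v ∷ w ∷ x ∷ y ∷ z ∷ []) ⟩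
      W * ((A + (B + (C + (D + (E + (F + 0)))))) + (v + (w + (x + (y + z))))) ∎
      where open ≡-Reasoning

module Combinatorics where

  open NodeSums
  open import Data.Bool.Base using (Bool; true; false; if_then_else_)
  open import Data.Fin.Subset using (Subset; _∈_; _⊆_; ∣_∣)
  open import Data.Fin.Subset.Properties using (_∈?_; ⊆-antisym; p⊆q⇒∣p∣≤∣q∣)
  open import Data.List.Base using (List; []; _∷_; _++_; map; filter; length)
  open import Data.List.Membership.DecPropositional ℕ._≟_ using () renaming (_∈?_ to _∈ˡ?_)
  open import Data.List.Membership.Propositional using () renaming (_∈_ to _∈ˡ_)
  open import Data.List.Membership.Propositional.Properties
    using (∈-++⁺ˡ; ∈-++⁺ʳ; ∈-++⁻; ∈-map⁺; ∈-map⁻; ∈-filter⁺; ∈-filter⁻)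
  open import Data.List.Membership.Propositional.Properties.WithK using (unique∧set⇒bag)
  open import Data.List.Properties using (filter-++; length-++)
  open import Data.List.Relation.Binary.BagAndSetEquality using (∼bag⇒↭)
  open import Data.List.Relation.Binary.Permutation.Propositional.Properties using (↭-length)
  open import Data.List.Relation.Unary.All using (All; []; _∷_)
  import Data.List.Relation.Unary.All as All
  open import Data.List.Relation.Unary.Any using (here; there)
  open import Data.List.Relation.Unary.Unique.Propositional using (Unique; []; _∷_)
  import Data.List.Relation.Unary.Unique.Propositional.Properties as Unique
  open import Data.Nat hiding (parity; NonZero; zero; suc; ℕ)
  open import Data.Nat.Divisibility using (_∣_; divides)
  open import Data.Nat.Properties
  open import Data.Unit using (⊤; tt)
  import Data.Vec.Base as Vec
  import Data.Vec.Properties as Vec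
  open import Function.Base using (_∘_)
  open import Function.Bundles using (mk⇔; Equivalence)
  open import Relation.Binary.PropositionalEquality
    using (_≢_; sym; trans; subst; subst₂; cong₂; module ≡-Reasoning)

  private variable
    a b c d x y z u v α N : ℕ

  -- Trees and the uniqueness of triangulations with given cell counts

  data Tree   : ℕ → ℕ → Set
  data Forest : ℕ → ℕ → Set

  -- A tree over a and b is a dissection of the polygon with vertices a, …, b; in
  -- node t f, the tree t and those of f lie behind the sides of the cell at the
  -- segment from a to b.
  data Tree where
    leaf : Tree a (suc a)
    node : Tree a c → Forest c b → Tree a b

  data Forest where
    [_] : Tree a b → Forest a b
    _∷_ : Tree a c → Forest c b → Forest a b

  δ : ℕ → ℕ → ℕ
  δ v α = if does (v ≟ α) then 1 else 0

  occurrences : List ℕ → ℕ → ℕ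
  occurrences []      α = 0
  occurrences (v ∷ w) α = δ v α + occurrences w α

  vertices : Forest a b → List ℕ
  vertices {a} {b} [ t ]   = a ∷ b ∷ []
  vertices {a}     (t ∷ f) = a ∷ vertices f

  cellCount   : Tree a b → ℕ → ℕ
  cellCountᶠ : Forest a b → ℕ → ℕ
  cellCount leaf       α = 0
  cellCount (node t f) α = occurrences (vertices (t ∷ f)) α + (cellCount t α + cellCountᶠ f α)
  cellCountᶠ [ t ]   α = cellCount t α
  cellCountᶠ (t ∷ f) α = cellCount t α + cellCountᶠ f α

  tree-<   : Tree a b → a < b
  forest-< : Forest a b → a < b
  tree-< leaf       = ≤-refl
  tree-< (node t f) = <-trans (tree-< t) (forest-< f)
  forest-< [ t ]   = tree-< t
  forest-< (t ∷ f) = <-trans (tree-< t) (forest-< f)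

  δ-refl : ∀ α → δ α α ≡ 1
  δ-refl α = cong (if_then 1 else 0) (dec-true (α ≟ α) refl)

  δ-≢ : ∀ {v α} → v ≢ α → δ v α ≡ 0
  δ-≢ {v} {α} v≢α = cong (if_then 1 else 0) (dec-false (v ≟ α) v≢α)

  Outside : ℕ → ℕ → ℕ → Set
  Outside a b α = α < a ⊎ b < α

  occurrences-outside : (f : Forest a b) → Outside a b α → occurrences (vertices f) α ≡ 0
  occurrences-outside [ t ] (inj₁ α<a)
    rewrite δ-≢ (>⇒≢ α<a) | δ-≢ (>⇒≢ (<-trans α<a (tree-< t))) = refl
  occurrences-outside [ t ] (inj₂ b<α)
    rewrite δ-≢ (<⇒≢ b<α) | δ-≢ (<⇒≢ (<-trans (tree-< t) b<α)) = refl
  occurrences-outside (t ∷ f) (inj₁ α<a)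
    rewrite δ-≢ (>⇒≢ α<a) = occurrences-outside f (inj₁ (<-trans α<a (tree-< t)))
  occurrences-outside (t ∷ f) (inj₂ b<α)
    rewrite δ-≢ (<⇒≢ (<-trans (<-trans (tree-< t) (forest-< f)) b<α)) =
    occurrences-outside f (inj₂ b<α)

  outside-left : Tree a c → Forest c b → Outside a b α → Outside a c α
  outside-left t f (inj₁ α<a) = inj₁ α<a
  outside-left t f (inj₂ b<α) = inj₂ (<-trans (forest-< f) b<α)

  outside-right : Tree a c → Forest c b → Outside a b α → Outside c b α
  outside-right t f (inj₁ α<a) = inj₁ (<-trans α<a (tree-< t))
  outside-right t f (inj₂ b<α) = inj₂ b<α

  cellCount-outside  : (t : Tree a b) → Outside a b α → cellCount t α ≡ 0
  cellCountᶠ-outside : (f : Forest a b) → Outside a b α → cellCountᶠ f α ≡ 0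
  cellCount-outside leaf o = refl
  cellCount-outside (node t f) o
    rewrite occurrences-outside (t ∷ f) o
          | cellCount-outside t (outside-left t f o) = cellCountᶠ-outside f (outside-right t f o)
  cellCountᶠ-outside [ t ]   o = cellCount-outside t o
  cellCountᶠ-outside (t ∷ f) o
    rewrite cellCount-outside t (outside-left t f o) = cellCountᶠ-outside f (outside-right t f o)

  -- Triangulations as binary trees, and their subtrees

  data Tri : ℕ → ℕ → Set where
    leaf : Tri a (suc a)
    node : Tri a c → Tri c b → Tri a b

  ⟦_⟧ : Tri a b → Tree a b
  ⟦ leaf ⟧     = leaf
  ⟦ node l r ⟧ = node ⟦ l ⟧ [ ⟦ r ⟧ ]

  triCount : Tri a b → ℕ → ℕ
  triCount t = cellCount ⟦ t ⟧

  tri-< : Tri a b → a < b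
  tri-< t = tree-< ⟦ t ⟧

  infix 4 _⊑_
  data _⊑_ {a b} (s : Tri a b) : Tri x y → Set where
    here  : s ⊑ s
    left  : {l : Tri x c} {r : Tri c y} → s ⊑ l → s ⊑ node l r
    right : {l : Tri x c} {r : Tri c y} → s ⊑ r → s ⊑ node l r

  ⊑-≤ : {s : Tri a b} {t : Tri x y} → s ⊑ t → x ≤ a × b ≤ y
  ⊑-≤ here = ≤-refl , ≤-refl
  ⊑-≤ (left {r = r} p)  = let q , q′ = ⊑-≤ p in q , ≤-trans q′ (<⇒≤ (tri-< r))
  ⊑-≤ (right {l = l} p) = let q , q′ = ⊑-≤ p in ≤-trans (<⇒≤ (tri-< l)) q , q′

  ⊑-trans : {s : Tri a b} {t : Tri x y} {u : Tri c d} → s ⊑ t → t ⊑ u → s ⊑ u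
  ⊑-trans p here      = p
  ⊑-trans p (left q)  = left (⊑-trans p q)
  ⊑-trans p (right q) = right (⊑-trans p q)

  node-count-apex : (l : Tri a c) (r : Tri c b) →
    triCount (node l r) c ≡ 1 + (triCount l c + triCount r c)
  node-count-apex {c = c} l r
    rewrite δ-≢ (<⇒≢ (tri-< l)) | δ-refl c | δ-≢ (>⇒≢ (tri-< r)) = refl

  node-count-left : (l : Tri a c) (r : Tri c b) → a < α → α < c →
    triCount (node l r) α ≡ triCount l α
  node-count-left l r a<α α<c
    rewrite δ-≢ (<⇒≢ a<α) | δ-≢ (>⇒≢ α<c) | δ-≢ (>⇒≢ (<-trans α<c (tri-< r)))
          | cellCount-outside ⟦ r ⟧ (inj₁ α<c) = +-identityʳ _

  node-count-right : (l : Tri a c) (r : Tri c b) → c < α → α < b →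
    triCount (node l r) α ≡ triCount r α
  node-count-right l r c<α α<b
    rewrite δ-≢ (<⇒≢ (<-trans (tri-< l) c<α)) | δ-≢ (<⇒≢ c<α) | δ-≢ (>⇒≢ α<b)
          | cellCount-outside ⟦ l ⟧ (inj₂ c<α) = refl

  -- No cell outside a subtree meets a vertex strictly between its end points, so the surroundings
  -- do not alter the count there.
  subtree-count : {s : Tri a b} {t : Tri x y} → s ⊑ t → a < α → α < b →
    triCount t α ≡ triCount s α
  subtree-count here a<α α<b = refl
  subtree-count (left {l = l} {r} p) a<α α<b =
    let x≤a , b≤c = ⊑-≤ p in
    trans (node-count-left l r (≤-<-trans x≤a a<α) (<-≤-trans α<b b≤c)) (subtree-count p a<α α<b)
  subtree-count (right {l = l} {r} p) a<α α<b =
    let c≤a , b≤y = ⊑-≤ p in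
    trans (node-count-right l r (≤-<-trans c≤a a<α) (<-≤-trans α<b b≤y)) (subtree-count p a<α α<b)

  leaf-⊑ : (t : Tri x y) → x ≤ a → a < y → leaf {a} ⊑ t
  leaf-⊑ leaf x≤a a<y with refl ← ≤-antisym x≤a (≤-pred a<y) = here
  leaf-⊑ {a = a} (node {c = c} l r) x≤a a<y with a <? c
  ... | yes a<c = left (leaf-⊑ l x≤a a<c)
  ... | no  a≮c = right (leaf-⊑ r (≮⇒≥ a≮c) a<y)

  node-count-left-≤ : (l : Tri a c) (r : Tri c b) → triCount l α ≤ triCount (node l r) α
  node-count-left-≤ {α = α} l r =
    ≤-trans (m≤m+n _ (triCount r α)) (m≤n+m _ (occurrences (vertices (⟦ l ⟧ ∷ [ ⟦ r ⟧ ])) α))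

  node-count-right-≤ : (l : Tri a c) (r : Tri c b) → triCount r α ≤ triCount (node l r) α
  node-count-right-≤ {α = α} l r = ≤-trans (m≤n+m _ (triCount l α)) (m≤n+m _ (occurrences (vertices (⟦ l ⟧ ∷ [ ⟦ r ⟧ ])) α))

  -- A proper subtree ending at `b` lies in the right child of a node ending at `b`, and the cell of
  -- this node is a further cell at `b`. Equality is between pairs because the left end points may
  -- differ.
  endpoint-⊑ʳ : {s : Tri a b} {t : Tri x b} → s ⊑ t →
    (_≡_ {A = ∃ λ u → Tri u b} (a , s) (x , t)) ⊎ 1 + triCount s b ≤ triCount t b
  endpoint-⊑ʳ here = inj₁ refl
  endpoint-⊑ʳ (left {r = r} p) = ⊥-elim (<⇒≱ (tri-< r) (proj₂ (⊑-≤ p)))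
  endpoint-⊑ʳ {b = b} {s = s} (right {x = x} {c = c} {l = l} {r} p) = inj₂ (≤-trans lemma bound)
    where
    lemma : 1 + triCount s b ≤ 1 + triCount r b
    lemma with endpoint-⊑ʳ p
    ... | inj₁ refl = ≤-refl
    ... | inj₂ q    = s≤s (≤-trans (n≤1+n _) q)
    bound : 1 + triCount r b ≤ triCount (node l r) b
    bound rewrite δ-≢ (<⇒≢ (tri-< r)) | δ-≢ (<⇒≢ (<-trans (tri-< l) (tri-< r))) | δ-refl b =
      s≤s (m≤n+m _ (triCount l b))

  endpoint-⊑ˡ : {s : Tri a b} {t : Tri a y} → s ⊑ t →
    (_≡_ {A = ∃ (Tri a)} (b , s) (y , t)) ⊎ 1 + triCount s a ≤ triCount t a
  endpoint-⊑ˡ here = inj₁ refl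
  endpoint-⊑ˡ (right {l = l} p) = ⊥-elim (<⇒≱ (tri-< l) (proj₁ (⊑-≤ p)))
  endpoint-⊑ˡ {a = a} {s = s} (left {l = l} {r} p) = inj₂ (≤-trans lemma bound)
    where
    lemma : 1 + triCount s a ≤ 1 + triCount l a
    lemma with endpoint-⊑ˡ p
    ... | inj₁ refl = ≤-refl
    ... | inj₂ q    = s≤s (≤-trans (n≤1+n _) q)
    bound : 1 + triCount l a ≤ triCount (node l r) a
    bound rewrite δ-≢ (>⇒≢ (tri-< l)) | δ-≢ (>⇒≢ (<-trans (tri-< l) (tri-< r))) | δ-refl a =
      s≤s (m≤m+n _ (triCount r a))

  -- In the smallest subtree of `t` that contains both, `l` sits at the right end of the left child
  -- and `r` at the left end of the right child. Unless each fills its child, the vertex `c` gains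
  -- the cell of this subtree and, by the end point lemmas, at least one more.
  adjacent-⊑ : {l : Tri a c} {r : Tri c b} {t : Tri x y} → l ⊑ t → r ⊑ t →
    node l r ⊑ t ⊎ 2 + (triCount l c + triCount r c) ≤ triCount t c
  adjacent-⊑ {r = r} here q = ⊥-elim (<⇒≱ (tri-< r) (proj₂ (⊑-≤ q)))
  adjacent-⊑ {l = l} p here = ⊥-elim (<⇒≱ (tri-< l) (proj₁ (⊑-≤ p)))
  adjacent-⊑ (left {l = L} {R} p) (left q) with adjacent-⊑ p q
  ... | inj₁ s = inj₁ (left s)
  ... | inj₂ s = inj₂ (≤-trans s (node-count-left-≤ L R))
  adjacent-⊑ (right {l = L} {R} p) (right q) with adjacent-⊑ p q
  ... | inj₁ s = inj₁ (right s)
  ... | inj₂ s = inj₂ (≤-trans s (node-count-right-≤ L R))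
  adjacent-⊑ {l = l} {r} (right p) (left q) =
    ⊥-elim (<-irrefl refl (<-≤-trans (<-trans (≤-<-trans (proj₁ (⊑-≤ p)) (tri-< l)) (tri-< r)) (proj₂ (⊑-≤ q))))
  adjacent-⊑ {c = c} {l = l} {r} (left {l = L} {R} p) (right q)
    with refl ← ≤-antisym (proj₂ (⊑-≤ p)) (proj₁ (⊑-≤ q))
    rewrite node-count-apex L R with endpoint-⊑ʳ p | endpoint-⊑ˡ q
  ... | inj₁ refl | inj₁ refl = inj₁ here
  ... | inj₁ refl | inj₂ u    = inj₂ (s≤s (≤-trans (≤-reflexive (sym (+-suc _ _))) (+-monoʳ-≤ (triCount l c) u)))
  ... | inj₂ u    | inj₁ refl = inj₂ (s≤s (+-monoˡ-≤ (triCount r c) u))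
  ... | inj₂ u    | inj₂ v    = inj₂ (s≤s (+-mono-≤ u (≤-trans (n≤1+n _) v)))

  -- By induction both children of `s` occur in `t′`. If they did not form a node there, `t′` would
  -- have at least two cells at the apex `c` beyond those of the children, whereas `s`, and hence
  -- `t`, has exactly one.
  count-⊑ : {t t′ : Tri x y} → (∀ α → triCount t α ≡ triCount t′ α) →
    (s : Tri a b) → s ⊑ t → s ⊑ t′
  count-⊑ {t′ = t′} eq leaf p = leaf-⊑ t′ (proj₁ (⊑-≤ p)) (proj₂ (⊑-≤ p))
  count-⊑ {t = t} {t′} eq (node {c = c} l r) p
    with adjacent-⊑ (count-⊑ eq l (⊑-trans (left here) p)) (count-⊑ eq r (⊑-trans (right here) p))
  ... | inj₁ q = q
  ... | inj₂ q = ⊥-elim (<-irrefl refl (≤-trans q (≤-reflexive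
    (trans (sym (eq c)) (trans (subtree-count p (tri-< l) (tri-< r)) (node-count-apex l r))))))

  ⊑-≡ : {s t : Tri a b} → s ⊑ t → s ≡ t
  ⊑-≡ here = refl
  ⊑-≡ (left {r = r} p)  = ⊥-elim (<⇒≱ (tri-< r) (proj₂ (⊑-≤ p)))
  ⊑-≡ (right {l = l} p) = ⊥-elim (<⇒≱ (tri-< l) (proj₁ (⊑-≤ p)))

  -- The whole of `t` occurs in `t′` by `count-⊑`, and a subtree with the end points of the full
  -- tree is the full tree.
  triCount-injective : {t t′ : Tri a b} → (∀ α → triCount t α ≡ triCount t′ α) → t ≡ t′
  triCount-injective {t = t} eq = ⊑-≡ (count-⊑ eq t here)

  -- Segments

  module _ {P : Pred ℕ 0ℓ} (P? : ∀ z → Dec (P z)) where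

    first-from : ∀ l → l ≤ y → P y →
      ∃ λ z → l ≤ z × z ≤ y × P z × (∀ w → l ≤ w → w < z → ¬ P w)
    first-from {y} l l≤y py with m≤n⇒∃[o]m+o≡n l≤y
    ... | k , refl = go k l ≤-refl (λ w l≤w w<l _ → <⇒≱ w<l l≤w) refl
      where
      go : ∀ j m → l ≤ m → (∀ w → l ≤ w → w < m → ¬ P w) → m + j ≡ y →
        ∃ λ z → l ≤ z × z ≤ y × P z × (∀ w → l ≤ w → w < z → ¬ P w)
      go zero m l≤m none eq with refl ← trans (sym (+-identityʳ m)) eq =
        m , l≤m , ≤-refl , py , none
      go (suc j) m l≤m none eq with P? m
      ... | yes pm = m , l≤m , subst (m ≤_) eq (m≤m+n m _) , pm , none
      ... | no ¬pm = go j (suc m) (m≤n⇒m≤1+n l≤m) none′ (trans (sym (+-suc m j)) eq)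
        where
        none′ : ∀ w → l ≤ w → w < suc m → ¬ P w
        none′ w l≤w w≤m pw with m≤n⇒m<n∨m≡n (≤-pred w≤m)
        ... | inj₁ w<m  = none w l≤w w<m pw
        ... | inj₂ refl = ¬pm pw

    last-to : ∀ u → x ≤ u → P x →
      ∃ λ z → x ≤ z × z ≤ u × P z × (∀ w → z < w → w ≤ u → ¬ P w)
    last-to zero    z≤n px = zero , z≤n , z≤n , px , λ w 0<w w≤0 _ → <⇒≱ 0<w w≤0
    last-to (suc u) x≤u px with P? (suc u)
    ... | yes p = suc u , x≤u , ≤-refl , p , λ w z<w w≤z _ → <⇒≱ z<w w≤z
    ... | no ¬p with m≤n⇒m<n∨m≡n x≤u
    ...   | inj₂ refl = ⊥-elim (¬p px)
    ...   | inj₁ x<u with last-to u (≤-pred x<u) px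
    ...     | z , x≤z , z≤u , pz , none = z , x≤z , m≤n⇒m≤1+n z≤u , pz , none′
      where
      none′ : ∀ w → z < w → w ≤ suc u → ¬ P w
      none′ w z<w w≤u with m≤n⇒m<n∨m≡n w≤u
      ... | inj₁ w<u  = none w z<w (≤-pred w<u)
      ... | inj₂ refl = ¬p

  Segment  : Tree a b → ℕ → ℕ → Set
  Segmentᶠ : Forest a b → ℕ → ℕ → Set
  Segment {a} {b} leaf       x y = x ≡ a × y ≡ b
  Segment {a} {b} (node t f) x y = (x ≡ a × y ≡ b) ⊎ (Segment t x y ⊎ Segmentᶠ f x y)
  Segmentᶠ [ t ]   x y = Segment t x y
  Segmentᶠ (t ∷ f) x y = Segment t x y ⊎ Segmentᶠ f x y

  segment?  : (t : Tree a b) → Decidable (Segment t)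
  segmentᶠ? : (f : Forest a b) → Decidable (Segmentᶠ f)
  segment? {a} {b} leaf       x y = x ≟ a ×-dec y ≟ b
  segment? {a} {b} (node t f) x y = (x ≟ a ×-dec y ≟ b) ⊎-dec (segment? t x y ⊎-dec segmentᶠ? f x y)
  segmentᶠ? [ t ]   x y = segment? t x y
  segmentᶠ? (t ∷ f) x y = segment? t x y ⊎-dec segmentᶠ? f x y

  segment-root : (t : Tree a b) → Segment t a b
  segment-root leaf       = refl , refl
  segment-root (node t f) = inj₁ (refl , refl)

  segment-≤  : (t : Tree a b) → Segment t x y → a ≤ x × x < y × y ≤ b
  segmentᶠ-≤ : (f : Forest a b) → Segmentᶠ f x y → a ≤ x × x < y × y ≤ b
  segment-≤ leaf (refl , refl) = ≤-refl , ≤-refl , ≤-refl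
  segment-≤ (node t f) (inj₁ (refl , refl)) = ≤-refl , <-trans (tree-< t) (forest-< f) , ≤-refl
  segment-≤ (node t f) (inj₂ (inj₁ s)) =
    let p , q , r = segment-≤ t s in p , q , ≤-trans r (<⇒≤ (forest-< f))
  segment-≤ (node t f) (inj₂ (inj₂ s)) =
    let p , q , r = segmentᶠ-≤ f s in ≤-trans (<⇒≤ (tree-< t)) p , q , r
  segmentᶠ-≤ [ t ]   s        = segment-≤ t s
  segmentᶠ-≤ (t ∷ f) (inj₁ s) =
    let p , q , r = segment-≤ t s in p , q , ≤-trans r (<⇒≤ (forest-< f))
  segmentᶠ-≤ (t ∷ f) (inj₂ s) =
    let p , q , r = segmentᶠ-≤ f s in ≤-trans (<⇒≤ (tree-< t)) p , q , r

  Crossing : ℕ → ℕ → ℕ → ℕ → Set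
  Crossing x y u v = x < u × u < y × y < v

  segment-noncrossing  : (t : Tree a b) → Segment t x y → Segment t u v → ¬ Crossing x y u v
  segmentᶠ-noncrossing : (f : Forest a b) → Segmentᶠ f x y → Segmentᶠ f u v → ¬ Crossing x y u v
  apart-noncrossing : (t : Tree a c) (f : Forest c b) →
    Segment t x y ⊎ Segmentᶠ f x y → Segment t u v ⊎ Segmentᶠ f u v → ¬ Crossing x y u v
  segment-noncrossing leaf (refl , refl) (refl , refl) (x<u , _) = <-irrefl refl x<u
  segment-noncrossing t@(node _ _) (inj₁ (refl , refl)) s (_ , _ , y<v) =
    <⇒≱ y<v (proj₂ (proj₂ (segment-≤ t s)))
  segment-noncrossing t@(node _ _) s (inj₁ (refl , refl)) (x<u , _ , _) =
    <⇒≱ x<u (proj₁ (segment-≤ t s))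
  segment-noncrossing (node t f) (inj₂ s) (inj₂ s′) = apart-noncrossing t f s s′
  segmentᶠ-noncrossing [ t ]   s s′ = segment-noncrossing t s s′
  segmentᶠ-noncrossing (t ∷ f) s s′ = apart-noncrossing t f s s′
  apart-noncrossing t f (inj₁ s) (inj₁ s′) = segment-noncrossing t s s′
  apart-noncrossing t f (inj₂ s) (inj₂ s′) = segmentᶠ-noncrossing f s s′
  apart-noncrossing t f (inj₁ s) (inj₂ s′) (_ , u<y , _) =
    <⇒≱ (<-≤-trans u<y (proj₂ (proj₂ (segment-≤ t s)))) (proj₁ (segmentᶠ-≤ f s′))
  apart-noncrossing t f (inj₂ s) (inj₁ s′) (x<u , u<y , y<v) =
    <⇒≱ (<-≤-trans (<-trans x<u (<-trans u<y y<v)) (proj₂ (proj₂ (segment-≤ t s′)))) (proj₁ (segmentᶠ-≤ f s))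

  segment-edge  : (t : Tree a b) → a ≤ x → x < b → Segment t x (suc x)
  segmentᶠ-edge : (f : Forest a b) → a ≤ x → x < b → Segmentᶠ f x (suc x)
  segment-edge leaf a≤x x<b with refl ← ≤-antisym (≤-pred x<b) a≤x = refl , refl
  segment-edge {x = x} (node {c = c} t f) a≤x x<b with x <? c
  ... | yes x<c = inj₂ (inj₁ (segment-edge t a≤x x<c))
  ... | no  x≮c = inj₂ (inj₂ (segmentᶠ-edge f (≮⇒≥ x≮c) x<b))
  segmentᶠ-edge [ t ] a≤x x<b = segment-edge t a≤x x<b
  segmentᶠ-edge {x = x} (_∷_ {c = c} t f) a≤x x<b with x <? c
  ... | yes x<c = inj₁ (segment-edge t a≤x x<c)
  ... | no  x≮c = inj₂ (segmentᶠ-edge f (≮⇒≥ x≮c) x<b)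

  vertices-≤ : (f : Forest a b) → z ∈ˡ vertices f → a ≤ z × z ≤ b
  vertices-≤ [ t ] (here refl)         = ≤-refl , <⇒≤ (tree-< t)
  vertices-≤ [ t ] (there (here refl)) = <⇒≤ (tree-< t) , ≤-refl
  vertices-≤ (t ∷ f) (here refl) = ≤-refl , <⇒≤ (<-trans (tree-< t) (forest-< f))
  vertices-≤ (t ∷ f) (there p)   =
    let q , r = vertices-≤ f p in ≤-trans (<⇒≤ (tree-< t)) q , r

  first-vertex : (f : Forest a b) → a ∈ˡ vertices f
  first-vertex [ t ]   = here refl
  first-vertex (t ∷ f) = here refl

  last-vertex : (f : Forest a b) → b ∈ˡ vertices f
  last-vertex [ t ]   = there (here refl)
  last-vertex (t ∷ f) = there (last-vertex f)

  consecutive-segment : (f : Forest a b) → x ∈ˡ vertices f → y ∈ˡ vertices f → x < y →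
    (∀ z → z ∈ˡ vertices f → ¬ (x < z × z < y)) → Segmentᶠ f x y
  consecutive-segment [ t ] (here refl) (here refl) x<y none = ⊥-elim (<-irrefl refl x<y)
  consecutive-segment [ t ] (here refl) (there (here refl)) x<y none = segment-root t
  consecutive-segment [ t ] (there (here refl)) q x<y none =
    ⊥-elim (<⇒≱ x<y (proj₂ (vertices-≤ [ t ] q)))
  consecutive-segment (t ∷ f) (here refl) (here refl) x<y none = ⊥-elim (<-irrefl refl x<y)
  consecutive-segment (_∷_ {c = c} t f) (here refl) (there q) x<y none
    with refl ← ≤-antisym (≮⇒≥ λ c<y → none c (there (first-vertex f)) (tree-< t , c<y))
                          (proj₁ (vertices-≤ f q)) = inj₁ (segment-root t)
  consecutive-segment (t ∷ f) (there p) (here refl) x<y none =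
    ⊥-elim (<-asym x<y (<-≤-trans (tree-< t) (proj₁ (vertices-≤ f p))))
  consecutive-segment (t ∷ f) (there p) (there q) x<y none =
    inj₂ (consecutive-segment f p q x<y λ z r → none z (there r))

  -- Every segment of a forest, however deep, lies behind a single side of the cell and so passes
  -- over no vertex of it.
  segment-consecutive : (f : Forest a b) → Segmentᶠ f x y →
    z ∈ˡ vertices f → ¬ (x < z × z < y)
  segment-consecutive [ t ] s (here refl) (x<z , z<y) = <⇒≱ x<z (proj₁ (segment-≤ t s))
  segment-consecutive [ t ] s (there (here refl)) (x<z , z<y) =
    <⇒≱ z<y (proj₂ (proj₂ (segment-≤ t s)))
  segment-consecutive (t ∷ f) s (here refl) (x<z , z<y) =
    <⇒≱ x<z (proj₁ (segmentᶠ-≤ (t ∷ f) s))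
  segment-consecutive (t ∷ f) (inj₁ s) (there p) (x<z , z<y) =
    <⇒≱ z<y (≤-trans (proj₂ (proj₂ (segment-≤ t s))) (proj₁ (vertices-≤ f p)))
  segment-consecutive (t ∷ f) (inj₂ s) (there p) = segment-consecutive f s p

  Uniform  : ℕ → Tree a b → Set
  Uniformᶠ : ℕ → Forest a b → Set
  Uniform k leaf       = ⊤
  Uniform k (node t f) = length (vertices (t ∷ f)) ≡ k × Uniform k t × Uniformᶠ k f
  Uniformᶠ k [ t ]   = Uniform k t
  Uniformᶠ k (t ∷ f) = Uniform k t × Uniformᶠ k f

  ⟦⟧-uniform : (t : Tri a b) → Uniform 3 ⟦ t ⟧
  ⟦⟧-uniform leaf       = tt
  ⟦⟧-uniform (node l r) = refl , ⟦⟧-uniform l , ⟦⟧-uniform r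

  uniform⇒⟦⟧ : (t : Tree a b) → Uniform 3 t → ∃ λ (s : Tri a b) → ⟦ s ⟧ ≡ t
  uniform⇒⟦⟧ leaf _ = leaf , refl
  uniform⇒⟦⟧ (node t [ t′ ]) (_ , u , u′)
    with s , refl ← uniform⇒⟦⟧ t u | s′ , refl ← uniform⇒⟦⟧ t′ u′ = node s s′ , refl
  uniform⇒⟦⟧ (node t (t′ ∷ [ _ ])) (() , _)
  uniform⇒⟦⟧ (node t (t′ ∷ (_ ∷ [ _ ]))) (() , _)
  uniform⇒⟦⟧ (node t (t′ ∷ (_ ∷ (_ ∷ _)))) (() , _)

  -- Trees of non-crossing relations

  module _ (J : Rel ℕ 0ℓ) where

    -- Completeness is asked only between `a` and `b`, so that the property passes to subtrees.
    record Represents (t : Tree a b) : Set where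
      field
        sound    : ∀ {x y} → Segment t x y → J x y
        complete : ∀ {x y} → a ≤ x → y ≤ b → J x y → Segment t x y

    record Representsᶠ (f : Forest a b) : Set where
      field
        sound    : ∀ {x y} → Segmentᶠ f x y → J x y
        complete : ∀ {x y} → a ≤ x → y ≤ b → J x y → Segmentᶠ f x y

  module Construction (J : Rel ℕ 0ℓ) (J? : Decidable J)
    (J-suc : ∀ x → J x (suc x)) (J-< : ∀ {x y} → J x y → x < y)
    (J-noncrossing : ∀ {x y u v} → J x y → J u v → ¬ Crossing x y u v) where

    open Represents
    open Representsᶠ

    module _ (z≤d : z ≤ d) (last : ∀ w → z < w → w ≤ d → ¬ J a w) (az : J a z)
             (t : Tree a z) (f : Forest z b) (tᵣ : Represents J t) (fᵣ : Representsᶠ J f) where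

      -- A segment passing over `z` either starts after `a` and crosses the segment from `a` to `z`,
      -- or starts at `a` and contradicts the choice of `z` as the farthest neighbour of `a` up to
      -- `d`. The premise on `d` keeps the root segment out.
      split-complete : a ≤ x → y ≤ b → (x ≡ a → y ≤ d) → J x y → Segment t x y ⊎ Segmentᶠ f x y
      split-complete {x = x} {y} a≤x y≤b h xy with y ≤? z | z ≤? x
      ... | yes y≤z | _       = inj₁ (complete tᵣ a≤x y≤z xy)
      ... | no  y≰z | yes z≤x = inj₂ (complete fᵣ z≤x y≤b xy)
      ... | no  y≰z | no  z≰x with m≤n⇒m<n∨m≡n a≤x
      ...   | inj₁ a<x  = ⊥-elim (J-noncrossing az xy (a<x , ≰⇒> z≰x , ≰⇒> y≰z))
      ...   | inj₂ refl = ⊥-elim (last y (≰⇒> y≰z) (h refl) xy)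

    -- The fuel `n` bounds `b` minus `a`. A forest may consist of one tree over the same interval,
    -- so forests of a given fuel call trees of the same fuel, while trees call only strictly
    -- shorter trees and forests.
    TreeBuilder ForestBuilder : ℕ → Set
    TreeBuilder n   = ∀ {a b} → b ≤ n + a → J a b → ∃ λ (t : Tree a b) → Represents J t
    ForestBuilder n = ∀ {a b} → b ≤ n + a → a < b → ∃ λ (f : Forest a b) → Representsᶠ J f

    fuel : ∀ {n} → a < z → b ≤ suc n + a → b ≤ n + z
    fuel {a} {n = n} a<z b≤ =
      ≤-trans b≤ (≤-trans (≤-reflexive (sym (+-suc n a))) (+-monoʳ-≤ n a<z))

    -- The vertex of the cell that follows `a` is the farthest one joined to `a` other than the far
    -- end of the root; the forest repeats this choice for the remaining vertices.
    treeStep : ∀ n → TreeBuilder n → ForestBuilder n → TreeBuilder (suc n)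
    treeStep n tree forest {a} {zero}  b≤ ab = ⊥-elim (n≮0 (J-< ab))
    treeStep n tree forest {a} {suc b} b≤ ab with m≤n⇒m<n∨m≡n (≤-pred (J-< ab))
    ... | inj₂ refl = leaf , record
      { sound    = λ { (refl , refl) → J-suc a }
      ; complete = λ a≤x y≤b xy →
          let x<y = J-< xy in
          ≤-antisym (≤-pred (≤-trans x<y y≤b)) a≤x , ≤-antisym y≤b (≤-trans (s≤s a≤x) x<y)
      }
    -- The root ends at `suc b`; the search stops at `b` so as not to find the root itself.
    ... | inj₁ a<b with last-to (J? a) b a<b (J-suc a)
    ...   | z , a<z , z≤b , az , last
      with tree (≤-trans z≤b (≤-pred b≤)) az | forest {z} {suc b} (fuel a<z b≤) (s≤s z≤b)
    ...     | t , tᵣ | f , fᵣ = node t f , record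
      { sound    = λ { (inj₁ (refl , refl)) → ab
                     ; (inj₂ (inj₁ s)) → sound tᵣ s ; (inj₂ (inj₂ s)) → sound fᵣ s }
      ; complete = complete′
      }
      where
      complete′ : ∀ {x y} → a ≤ x → y ≤ suc b → J x y → Segment (node t f) x y
      complete′ {x} {y} a≤x y≤b xy with x ≟ a ×-dec y ≟ suc b
      ... | yes eq = inj₁ eq
      ... | no neq = inj₂ (split-complete z≤b last az t f tᵣ fᵣ a≤x y≤b
                      (λ x≡a → ≤-pred (≤∧≢⇒< y≤b λ y≡b → neq (x≡a , y≡b))) xy)

    forestStep : ∀ n → TreeBuilder (suc n) → ForestBuilder n → ForestBuilder (suc n)
    forestStep n tree forest {a} {b} b≤ a<b with last-to (J? a) b a<b (J-suc a)
    ... | z , a<z , z≤b , az , last with m≤n⇒m<n∨m≡n z≤b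
    ...   | inj₂ refl = let t , tᵣ = tree b≤ az in
      [ t ] , record { sound = sound tᵣ ; complete = complete tᵣ }
    ...   | inj₁ z<b with tree (≤-trans z≤b b≤) az | forest {z} {b} (fuel a<z b≤) z<b
    ...     | t , tᵣ | f , fᵣ = t ∷ f , record
      { sound    = λ { (inj₁ s) → sound tᵣ s ; (inj₂ s) → sound fᵣ s }
      ; complete = λ a≤x y≤b → split-complete z≤b last az t f tᵣ fᵣ a≤x y≤b (λ _ → y≤b)
      }

    builders : ∀ n → TreeBuilder n × ForestBuilder n
    builders zero    = (λ b≤a ab → ⊥-elim (<⇒≱ (J-< ab) b≤a)) , (λ b≤a a<b → ⊥-elim (<⇒≱ a<b b≤a))
    builders (suc n) =
      let tree , forest = builders n
          tree′ = treeStep n tree forest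
      in  tree′ , forestStep n tree′ forest

    representation : J a b → ∃ λ (t : Tree a b) → Represents J t
    representation {a} {b} = proj₁ (builders b) (m≤m+n b a)

  -- Cells

  ∣tabulate∣-insert : (f g : Fin N → Bool) (i : Fin N) → f i ≡ false → g i ≡ true →
    (∀ j → j ≢ i → f j ≡ g j) → ∣ Vec.tabulate g ∣ ≡ suc ∣ Vec.tabulate f ∣
  ∣tabulate∣-insert f g Fin.zero p q eq rewrite p | q =
    cong (suc ∘ ∣_∣) (Vec.tabulate-cong λ j → sym (eq (Fin.suc j) λ ()))
  ∣tabulate∣-insert f g (Fin.suc i) p q eq rewrite eq Fin.zero (λ ())
    with ∣tabulate∣-insert (f ∘ Fin.suc) (g ∘ Fin.suc) i p q (λ j j≢i → eq (Fin.suc j) (j≢i ∘ Fin.suc-injective))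
       | g Fin.zero
  ... | ih | true  = cong suc ih
  ... | ih | false = ih

  opaque
    toSubset : List ℕ → Subset N
    toSubset w = Vec.tabulate λ i → does (toℕ i ∈ˡ? w)

    ∈-toSubset⁺ : ∀ {w} {i : Fin N} → toℕ i ∈ˡ w → i ∈ toSubset w
    ∈-toSubset⁺ {w = w} {i} p = Vec.lookup⇒[]= i _
      (trans (Vec.lookup∘tabulate (λ i → does (toℕ i ∈ˡ? w)) i) (dec-true (toℕ i ∈ˡ? w) p))

    ∈-toSubset⁻ : ∀ {w} {i : Fin N} → i ∈ toSubset w → toℕ i ∈ˡ w
    ∈-toSubset⁻ {w = w} {i} p with toℕ i ∈ˡ? w
      | trans (sym (Vec.[]=⇒lookup p)) (Vec.lookup∘tabulate (λ i → does (toℕ i ∈ˡ? w)) i)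
    ... | yes q | _  = q
    ... | no  _ | ()

    ∣toSubset∣ : ∀ {w} → Unique w → All (_< N) w → ∣ toSubset {N} w ∣ ≡ length w
    ∣toSubset∣ {N} [] [] = empty N
      where
      empty : ∀ N → ∣ Vec.tabulate {n = N} (λ _ → false) ∣ ≡ 0
      empty zero    = refl
      empty (suc N) = empty N
    ∣toSubset∣ {w = v ∷ w} (v∉w ∷ uw) (v<N ∷ w<N) = trans
      (∣tabulate∣-insert (λ i → does (toℕ i ∈ˡ? w)) (λ i → does (toℕ i ∈ˡ? (v ∷ w))) (fromℕ< v<N)
        (dec-false (_ ∈ˡ? w) λ p → All.lookup v∉w p (sym (Fin.toℕ-fromℕ< v<N)))
        (dec-true (_ ∈ˡ? (v ∷ w)) (here (Fin.toℕ-fromℕ< v<N)))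
        agree)
      (cong suc (∣toSubset∣ uw w<N))
      where
      agree : ∀ j → j ≢ fromℕ< v<N → does (toℕ j ∈ˡ? w) ≡ does (toℕ j ∈ˡ? (v ∷ w))
      agree j j≢v = does-⇔ (mk⇔ there λ
        { (here eq) → ⊥-elim (j≢v (Fin.toℕ-injective (trans eq (sym (Fin.toℕ-fromℕ< v<N)))))
        ; (there p) → p }) (toℕ j ∈ˡ? w) (toℕ j ∈ˡ? (v ∷ w))

  vertices-unique : (f : Forest a b) → Unique (vertices f)
  vertices-unique [ t ]   = (<⇒≢ (tree-< t) ∷ []) ∷ [] ∷ []
  vertices-unique (t ∷ f) =
    All.tabulate (λ p → <⇒≢ (<-≤-trans (tree-< t) (proj₁ (vertices-≤ f p)))) ∷ vertices-unique f

  vertices-length : (f : Forest a b) → 2 ≤ length (vertices f)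
  vertices-length [ t ]   = ≤-refl
  vertices-length (t ∷ f) = m≤n⇒m≤1+n (vertices-length f)

  ∣vertices∣ : b < N → (f : Forest a b) → ∣ toSubset {N} (vertices f) ∣ ≡ length (vertices f)
  ∣vertices∣ b<N f =
    ∣toSubset∣ (vertices-unique f) (All.tabulate λ p → ≤-<-trans (proj₂ (vertices-≤ f p)) b<N)

  opaque
    third-element : (S : Subset N) → 3 ≤ ∣ S ∣ → {i j : Fin N} → i ≢ j →
      ∃ λ k → k ∈ S × k ≢ i × k ≢ j
    third-element S 3≤S {i} {j} i≢j
      with Fin.any? (λ k → (k ∈? S) ×-dec (¬? (k Fin.≟ i) ×-dec ¬? (k Fin.≟ j)))
    ... | yes found = found
    ... | no  none  = ⊥-elim (<⇒≱ 3≤S (≤-trans (p⊆q⇒∣p∣≤∣q∣ S⊆ij) (≤-reflexive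
      (∣toSubset∣ ((i≢j ∘ Fin.toℕ-injective ∷ []) ∷ [] ∷ []) (Fin.toℕ<n i ∷ Fin.toℕ<n j ∷ [])))))
      where
      S⊆ij : S ⊆ toSubset (toℕ i ∷ toℕ j ∷ [])
      S⊆ij {k} k∈S with k Fin.≟ i | k Fin.≟ j
      ... | yes refl | _        = ∈-toSubset⁺ {w = toℕ i ∷ toℕ j ∷ []} (here refl)
      ... | no _     | yes refl = ∈-toSubset⁺ {w = toℕ i ∷ toℕ j ∷ []} (there (here refl))
      ... | no k≢i   | no k≢j   = ⊥-elim (none (k , k∈S , k≢i , k≢j))

  _∈ᴺ_ : ℕ → Subset N → Set
  z ∈ᴺ S = ∃ λ i → toℕ i ≡ z × i ∈ S

  _∈ᴺ?_ : (z : ℕ) (S : Subset N) → Dec (z ∈ᴺ S)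
  z ∈ᴺ? S = Fin.any? λ i → (toℕ i ≟ z) ×-dec (i ∈? S)

  opaque
    first-in : (S : Subset N) {i : Fin N} → i ∈ S → ∀ l → l ≤ toℕ i →
      ∃ λ j → l ≤ toℕ j × j Fin.≤ i × j ∈ S × (∀ k → k ∈ S → l ≤ toℕ k → j Fin.≤ k)
    first-in S i∈S l l≤i with first-from (_∈ᴺ? S) l l≤i (_ , refl , i∈S)
    ... | _ , l≤j , j≤i , (j , refl , j∈S) , none =
      j , l≤j , j≤i , j∈S , λ k k∈S l≤k → ≮⇒≥ λ k<j → none _ l≤k k<j (k , refl , k∈S)

    last-in : (S : Subset N) {i : Fin N} → i ∈ S → ∀ u → toℕ i ≤ u →
      ∃ λ j → i Fin.≤ j × toℕ j ≤ u × j ∈ S × (∀ k → k ∈ S → toℕ k ≤ u → k Fin.≤ j)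
    last-in S i∈S u i≤u with last-to (_∈ᴺ? S) u i≤u (_ , refl , i∈S)
    ... | _ , i≤j , j≤u , (j , refl , j∈S) , none =
      j , i≤j , j≤u , j∈S , λ k k∈S k≤u → ≮⇒≥ λ j<k → none _ j<k k≤u (k , refl , k∈S)

  joined? : (D : Dissection N) → Decidable (Joined D)
  joined? D i j = isEdge? i j ⊎-dec diag? D i j

  joined-noncrossing : (D : Dissection N) {i j k l : Fin N} → Joined D i j → Joined D k l →
    ¬ (i Fin.< k × k Fin.< j × j Fin.< l)
  joined-noncrossing D (inj₁ (inj₁ j≡1+i)) _ (i<k , k<j , _) =
    <⇒≱ i<k (≤-pred (subst (_ <_) j≡1+i k<j))
  joined-noncrossing D {l = l} (inj₁ (inj₂ (_ , 1+j≡N))) _ (_ , _ , j<l) =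
    <⇒≱ (Fin.toℕ<n l) (subst (_≤ toℕ l) 1+j≡N j<l)
  joined-noncrossing D (inj₂ _) (inj₁ (inj₁ l≡1+k)) (_ , k<j , j<l) =
    <⇒≱ k<j (≤-pred (subst (_ <_) l≡1+k j<l))
  joined-noncrossing D (inj₂ _) (inj₁ (inj₂ (k≡0 , _))) (i<k , _) =
    n≮0 (subst (_ <_) k≡0 i<k)
  joined-noncrossing D (inj₂ p) (inj₂ q) cross = noncrossing D p q cross

  Spans : Subset N → Fin N → Fin N → Set
  Spans S i j = i ∈ S × j ∈ S × (∀ k → k ∈ S → i Fin.≤ k × k Fin.≤ j)

  -- Two elements u < v of S′ enclosing a missing s ∈ S are joined; since the sides
  -- of S cannot cross u v, both u and v lie in S, where they are not neighbours.
  cell-⊆ : (D : Dissection N) {S S′ : Subset N} → IsCell D S → IsCell D S′ →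
    ∀ {i j} → Spans S i j → Spans S′ i j → S ⊆ S′
  cell-⊆ D {S} {S′} (_ , cell) (3≤S′ , cell′) {i} {j} (i∈S , j∈S , in-ij) (i∈S′ , j∈S′ , in-ij′) {s} s∈S
    with s ∈? S′
  ... | yes s∈S′ = s∈S′
  ... | no  s∉S′
    with last-in S′ i∈S′ (toℕ s) (proj₁ (in-ij s s∈S))
       | first-in S′ j∈S′ (toℕ s) (proj₂ (in-ij s s∈S))
  ... | u , i≤u , u≤s , u∈S′ , u-last | v , s≤v , v≤j , v∈S′ , v-first = ⊥-elim contra
    where
    u<s : u Fin.< s
    u<s = ≤∧≢⇒< u≤s λ u≡s → s∉S′ (subst (_∈ S′) (Fin.toℕ-injective u≡s) u∈S′)
    s<v : s Fin.< v
    s<v = ≤∧≢⇒< s≤v λ s≡v → s∉S′ (subst (_∈ S′) (Fin.toℕ-injective (sym s≡v)) v∈S′)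
    between : ∀ c → c ∈ S′ → ¬ (u Fin.< c × c Fin.< v)
    between c c∈S′ (u<c , c<v) with ≤-total (toℕ c) (toℕ s)
    ... | inj₁ c≤s = <⇒≱ u<c (u-last c c∈S′ c≤s)
    ... | inj₂ s≤c = <⇒≱ c<v (v-first c c∈S′ s≤c)
    uv : Joined D u v
    uv = proj₁ (cell′ u u∈S′ v v∈S′ (<-trans u<s s<v)) (inj₁ between)
    u∈S : u ∈ S
    u∈S with last-in S i∈S (toℕ u) i≤u | first-in S s∈S (suc (toℕ u)) u<s
    ... | x , _ , x≤u , x∈S , x-last | y , u<y , y≤s , y∈S , y-first with m≤n⇒m<n∨m≡n x≤u
    ...   | inj₂ x≡u = subst (_∈ S) (Fin.toℕ-injective x≡u) x∈S
    ...   | inj₁ x<u = ⊥-elim (joined-noncrossing D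
      (proj₁ (cell x x∈S y y∈S (<-trans x<u u<y)) (inj₁ gap)) uv (x<u , u<y , ≤-<-trans y≤s s<v))
      where
      gap : ∀ c → c ∈ S → ¬ (x Fin.< c × c Fin.< y)
      gap c c∈S (x<c , c<y) with ≤-<-connex (toℕ c) (toℕ u)
      ... | inj₁ c≤u = <⇒≱ x<c (x-last c c∈S c≤u)
      ... | inj₂ u<c = <⇒≱ c<y (y-first c c∈S u<c)
    v∈S : v ∈ S
    v∈S with first-in S j∈S (toℕ v) v≤j | last-in S s∈S (pred (toℕ v)) (<⇒≤pred s<v)
    ... | y , v≤y , _ , y∈S , y-first | x , s≤x , x≤v , x∈S , x-last with m≤n⇒m<n∨m≡n v≤y
    ...   | inj₂ v≡y = subst (_∈ S) (Fin.toℕ-injective (sym v≡y)) y∈S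
    ...   | inj₁ v<y = ⊥-elim (joined-noncrossing D uv
      (proj₁ (cell x x∈S y y∈S (<-trans x<v v<y)) (inj₁ gap)) (<-≤-trans u<s s≤x , x<v , v<y))
      where
      x<v : x Fin.< v
      x<v = ≤-<-trans x≤v (pred[n]<n {{>-nonZero (≤-<-trans z≤n s<v)}})
        where
        pred[n]<n : ∀ {n} .{{_ : NonZero n}} → pred n < n
        pred[n]<n {suc n} = ≤-refl
      gap : ∀ c → c ∈ S → ¬ (x Fin.< c × c Fin.< y)
      gap c c∈S (x<c , c<y) with ≤-<-connex (toℕ v) (toℕ c)
      ... | inj₁ v≤c = <⇒≱ c<y (y-first c c∈S v≤c)
      ... | inj₂ c<v = <⇒≱ x<c (x-last c c∈S (<⇒≤pred c<v))
    contra : ⊥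
    contra with proj₂ (cell u u∈S v v∈S (<-trans u<s s<v)) uv
    ... | inj₁ none = none s s∈S (u<s , s<v)
    -- If `u v` is the closing side of `S`, then all of `S′` lies between `u` and `v`, and nothing
    -- of it lies strictly between them: this leaves no room for a third vertex.
    ... | inj₂ all with third-element S′ 3≤S′ (Fin.<⇒≢ (<-trans u<s s<v))
    ...   | c , c∈S′ , c≢u , c≢v = between c c∈S′
      ( ≤∧≢⇒< (≤-trans (proj₁ (all i i∈S)) (proj₁ (in-ij′ c c∈S′))) (c≢u ∘ sym ∘ Fin.toℕ-injective)
      , ≤∧≢⇒< (≤-trans (proj₂ (in-ij′ c c∈S′)) (proj₂ (all j j∈S))) (c≢v ∘ Fin.toℕ-injective))

  -- Since cells are known from their extreme vertices, an arbitrary cell can be identified with the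
  -- one at the tree segment between these vertices.
  cell-unique : (D : Dissection N) {S S′ : Subset N} → IsCell D S → IsCell D S′ →
    ∀ {i j} → Spans S i j → Spans S′ i j → S ≡ S′
  cell-unique D {S} {S′} p p′ {i} {j} s s′ = ⊆-antisym
    (cell-⊆ D {S} {S′} p p′ {i} {j} s s′) (cell-⊆ D {S′} {S} p′ p {i} {j} s′ s)

  spans-cong : {S : Subset N} {i j i′ j′ : Fin N} → toℕ i ≡ toℕ i′ → toℕ j ≡ toℕ j′ →
    Spans S i j → Spans S i′ j′
  spans-cong {S = S} p q = subst₂ (Spans S) (Fin.toℕ-injective p) (Fin.toℕ-injective q)

  subsets-complete : (S : Subset N) → S ∈ˡ subsets N
  subsets-complete Vec.[] = here refl
  subsets-complete (false Vec.∷ S) = ∈-++⁺ˡ (∈-map⁺ _ (subsets-complete S))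
  subsets-complete {suc N} (true  Vec.∷ S) = ∈-++⁺ʳ (map (false Vec.∷_) (subsets N)) (∈-map⁺ _ (subsets-complete S))

  subsets-unique : ∀ N → Unique (subsets N)
  subsets-unique zero    = [] ∷ []
  subsets-unique (suc N) = Unique.++⁺
    (Unique.map⁺ Vec.∷-injectiveʳ (subsets-unique N)) (Unique.map⁺ Vec.∷-injectiveʳ (subsets-unique N))
    λ (p , q) → case (∈-map⁻ _ p) (∈-map⁻ _ q)
    where
    case : ∀ {N} {S : Subset (suc N)} {ps qs : List (Subset N)} →
      (∃ λ T → T ∈ˡ ps × S ≡ false Vec.∷ T) → (∃ λ T → T ∈ˡ qs × S ≡ true Vec.∷ T) → ⊥
    case (_ , _ , refl) (_ , _ , ())

  incident : Fin N → List (Subset N) → ℕ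
  incident i L = length (filter (i ∈?_) L)

  incident-++ : ∀ (i : Fin N) L L′ → incident i (L ++ L′) ≡ incident i L + incident i L′
  incident-++ i L L′ = trans (cong length (filter-++ (i ∈?_) L L′)) (length-++ (filter (i ∈?_) L))

  -- Two duplicate-free lists with the same elements are permutations of each other, so the search
  -- through all subsets may be replaced by any such list of the cells.
  incidence≡incident : (D : Dissection N) (i : Fin N) (L : List (Subset N)) → Unique L →
    (∀ S → IsCell D S → S ∈ˡ L) → (∀ S → S ∈ˡ L → IsCell D S) → incidence D i ≡ incident i L
  incidence≡incident {N} D i L L-unique L-complete L-sound =
    ↭-length (∼bag⇒↭ (unique∧set⇒bag
      (Unique.filter⁺ P? (subsets-unique N)) (Unique.filter⁺ (i ∈?_) L-unique) (mk⇔ to from)))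
    where
    P? : ∀ S → Dec (i ∈ S × IsCell D S)
    P? S = (i ∈? S) ×-dec isCell? D S
    to : ∀ {S} → S ∈ˡ filter P? (subsets N) → S ∈ˡ filter (i ∈?_) L
    to {S} p = let i∈S , cell = proj₂ (∈-filter⁻ P? {xs = subsets N} p) in
      ∈-filter⁺ (i ∈?_) (L-complete S cell) i∈S
    from : ∀ {S} → S ∈ˡ filter (i ∈?_) L → S ∈ˡ filter P? (subsets N)
    from {S} p = let S∈ , i∈S = ∈-filter⁻ (i ∈?_) {xs = L} p in
      ∈-filter⁺ P? (subsets-complete S) (i∈S , L-sound S S∈)

  -- The cells of a dissection as the nodes of its tree

  module _ {n : ℕ} where

    private
      M : ℕ
      M = 3 + n

    opaque
      -- The extreme vertices of a cell span its closing side, which is therefore joined; a third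
      -- vertex lies between them and makes the gap.
      cell-span : (D : Dissection M) {S : Subset M} → IsCell D S →
        ∃₂ λ i j → Spans S i j × Joined D i j × suc (toℕ i) < toℕ j
      cell-span D {S} (3≤S , cell)
        with third-element S 3≤S {Fin.zero} {Fin.suc Fin.zero} (λ ())
      ... | k , k∈S , _
        with first-in S k∈S 0 z≤n | last-in S k∈S (2 + n) (≤-pred (Fin.toℕ<n k))
      ...   | i , _ , i≤k , i∈S , i-first | j , k≤j , _ , j∈S , j-last =
        i , j , (i∈S , j∈S , in-ij) , proj₁ (cell i i∈S j j∈S i<j) (inj₂ in-ij) , gap
        where
        in-ij : ∀ c → c ∈ S → i Fin.≤ c × c Fin.≤ j
        in-ij c c∈S = i-first c c∈S z≤n , j-last c c∈S (≤-pred (Fin.toℕ<n c))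
        i<j : i Fin.< j
        i<j with third-element S 3≤S {i} {Fin.punchIn i Fin.zero} (Fin.punchInᵢ≢i i Fin.zero ∘ sym)
        -- The second excluded vertex, `punchIn i` of zero, is an arbitrary one different from `i`.
        ... | c , c∈S , c≢i , _ =
          <-≤-trans (≤∧≢⇒< (proj₁ (in-ij c c∈S)) (c≢i ∘ sym ∘ Fin.toℕ-injective)) (proj₂ (in-ij c c∈S))
        gap : suc (toℕ i) < toℕ j
        gap with third-element S 3≤S (Fin.<⇒≢ i<j)
        ... | c , c∈S , c≢i , c≢j = ≤-<-trans
          (≤∧≢⇒< (proj₁ (in-ij c c∈S)) (c≢i ∘ sym ∘ Fin.toℕ-injective))
          (≤∧≢⇒< (proj₂ (in-ij c c∈S)) (c≢j ∘ Fin.toℕ-injective))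

    module _ (D : Dissection M) where

      -- Successors are joined for all natural numbers, also beyond the polygon, since the
      -- construction of trees works with a relation on all of them.
      JoinedN : Rel ℕ 0ℓ
      JoinedN x y = y ≡ suc x ⊎ ∃₂ λ (i j : Fin M) → toℕ i ≡ x × toℕ j ≡ y × Joined D i j

      joinedN? : Decidable JoinedN
      joinedN? x y = (y ≟ suc x) ⊎-dec
        Fin.any? λ i → Fin.any? λ j → (toℕ i ≟ x) ×-dec ((toℕ j ≟ y) ×-dec joined? D i j)

      joinedN⇒joined : ∀ {i j} → JoinedN (toℕ i) (toℕ j) → Joined D i j
      joinedN⇒joined (inj₁ eq) = inj₁ (inj₁ eq)
      joinedN⇒joined (inj₂ (i , j , p , q , ij)) =
        subst₂ (Joined D) (Fin.toℕ-injective p) (Fin.toℕ-injective q) ij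

      joined⇒joinedN : ∀ {i j} → Joined D i j → JoinedN (toℕ i) (toℕ j)
      joined⇒joinedN ij = inj₂ (_ , _ , refl , refl , ij)

      joined-< : ∀ {i j} → Joined D i j → i Fin.< j
      joined-< (inj₁ (inj₁ eq)) = ≤-reflexive (sym eq)
      joined-< (inj₁ (inj₂ (i≡0 , 1+j≡M))) =
        subst₂ _<_ (sym i≡0) (sym (suc-injective 1+j≡M)) (s≤s z≤n)
      joined-< (inj₂ ij) = proj₁ (diagonal D ij)

      joinedN-< : JoinedN x y → x < y
      joinedN-< (inj₁ refl) = ≤-refl
      joinedN-< (inj₂ (i , j , refl , refl , ij)) = joined-< ij

      joinedN-noncrossing : JoinedN x y → JoinedN u v → ¬ Crossing x y u v
      joinedN-noncrossing (inj₁ refl) _ (x<u , u<y , _) = <⇒≱ x<u (≤-pred u<y)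
      joinedN-noncrossing (inj₂ _) (inj₁ refl) (_ , u<y , y<v) = <⇒≱ u<y (≤-pred y<v)
      joinedN-noncrossing (inj₂ (_ , _ , refl , refl , p)) (inj₂ (_ , _ , refl , refl , q)) =
        joined-noncrossing D p q

      joinedN-root : JoinedN 0 (2 + n)
      joinedN-root = inj₂ (Fin.zero , Fin.fromℕ (2 + n) , refl , Fin.toℕ-fromℕ _ ,
        inj₁ (inj₂ (refl , cong suc (Fin.toℕ-fromℕ _))))

      open Construction JoinedN joinedN? (λ _ → inj₁ refl) joinedN-< joinedN-noncrossing
        using (representation)

      IsTreeOf : Tree a b → Set
      IsTreeOf = Represents JoinedN

      IsForestOf : Forest a b → Set
      IsForestOf = Representsᶠ JoinedN

      opaque
        dissectionTree : ∃ λ (t : Tree 0 (2 + n)) → IsTreeOf t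
        dissectionTree = representation joinedN-root

    cellsOf  : Tree a b → List (Subset M)
    cellsOfᶠ : Forest a b → List (Subset M)
    cellsOf leaf       = []
    cellsOf (node t f) = toSubset (vertices (t ∷ f)) ∷ (cellsOf t ++ cellsOfᶠ f)
    cellsOfᶠ [ t ]   = cellsOf t
    cellsOfᶠ (t ∷ f) = cellsOf t ++ cellsOfᶠ f

    -- Having two elements is what separates cells in adjacent trees: their intervals share just one
    -- vertex.
    Within : ℕ → ℕ → Subset M → Set
    Within a b S = (∀ k → k ∈ S → a ≤ toℕ k × toℕ k ≤ b) × ∃₂ λ i j → i ∈ S × j ∈ S × i Fin.< j

    within-mono : ∀ {S} → x ≤ a → b ≤ y → Within a b S → Within x y S
    within-mono x≤a b≤y (in-ab , two) =
      (λ k k∈S → let p , q = in-ab k k∈S in ≤-trans x≤a p , ≤-trans q b≤y) , two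

    vertexˡ∈ : b < M → (f : Forest a b) → ∃ λ i → toℕ i ≡ a × i ∈ toSubset {M} (vertices f)
    vertexˡ∈ {b} {a} b<M f = fromℕ< a<M , Fin.toℕ-fromℕ< a<M ,
      ∈-toSubset⁺ {w = vertices f} (subst (_∈ˡ vertices f) (sym (Fin.toℕ-fromℕ< a<M)) (first-vertex f))
      where
      a<M : a < M
      a<M = <-trans (forest-< f) b<M

    vertexʳ∈ : b < M → (f : Forest a b) → ∃ λ i → toℕ i ≡ b × i ∈ toSubset {M} (vertices f)
    vertexʳ∈ b<M f = fromℕ< b<M , Fin.toℕ-fromℕ< b<M ,
      ∈-toSubset⁺ {w = vertices f} (subst (_∈ˡ vertices f) (sym (Fin.toℕ-fromℕ< b<M)) (last-vertex f))

    vertices-within : b < M → (f : Forest a b) → Within a b (toSubset (vertices f))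
    vertices-within b<M f with vertexˡ∈ b<M f | vertexʳ∈ b<M f
    ... | i , refl , i∈ | j , refl , j∈ =
      (λ k k∈ → vertices-≤ f (∈-toSubset⁻ {w = vertices f} k∈)) , i , j , i∈ , j∈ , forest-< f

    cells-within  : b < M → (t : Tree a b) → ∀ {S} → S ∈ˡ cellsOf t → Within a b S
    cellsᶠ-within : b < M → (f : Forest a b) → ∀ {S} → S ∈ˡ cellsOfᶠ f → Within a b S
    apart-within : b < M → (t : Tree a c) (f : Forest c b) → ∀ {S} →
      S ∈ˡ cellsOf t ++ cellsOfᶠ f → Within a b S
    cells-within b<M (node t f) (here refl) = vertices-within b<M (t ∷ f)
    cells-within b<M (node t f) (there p) = apart-within b<M t f p
    cellsᶠ-within b<M [ t ] p = cells-within b<M t p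
    cellsᶠ-within b<M (t ∷ f) p = apart-within b<M t f p
    apart-within b<M t f p with ∈-++⁻ (cellsOf t) p
    ... | inj₁ q = within-mono ≤-refl (<⇒≤ (forest-< f)) (cells-within (<-trans (forest-< f) b<M) t q)
    ... | inj₂ q = within-mono (<⇒≤ (tree-< t)) ≤-refl (cellsᶠ-within b<M f q)

    cells-unique  : b < M → (t : Tree a b) → Unique (cellsOf t)
    cellsᶠ-unique : b < M → (f : Forest a b) → Unique (cellsOfᶠ f)
    apart-unique : b < M → (t : Tree a c) (f : Forest c b) → Unique (cellsOf t ++ cellsOfᶠ f)
    cells-unique b<M leaf = []
    cells-unique {b} {a} b<M (node {c = c} t f) =
      All.tabulate (λ { p refl → fresh p }) ∷ apart-unique b<M t f
      where
      fresh : ¬ toSubset (vertices (t ∷ f)) ∈ˡ cellsOf t ++ cellsOfᶠ f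
      fresh p with vertexˡ∈ b<M (t ∷ f) | vertexʳ∈ b<M (t ∷ f) | ∈-++⁻ (cellsOf t) p
      ... | i , refl , i∈ | j , refl , j∈ | inj₁ q =
        <⇒≱ (forest-< f) (proj₂ (proj₁ (cells-within (<-trans (forest-< f) b<M) t q) j j∈))
      ... | i , refl , i∈ | j , refl , j∈ | inj₂ q =
        <⇒≱ (tree-< t) (proj₁ (proj₁ (cellsᶠ-within b<M f q) i i∈))
    cellsᶠ-unique b<M [ t ]   = cells-unique b<M t
    cellsᶠ-unique b<M (t ∷ f) = apart-unique b<M t f
    apart-unique b<M t f = Unique.++⁺
      (cells-unique (<-trans (forest-< f) b<M) t) (cellsᶠ-unique b<M f) λ (p , q) →
        let in-ac , i , j , i∈ , j∈ , i<j = cells-within (<-trans (forest-< f) b<M) t p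
            in-cb , _                     = cellsᶠ-within b<M f q
        in  <⇒≱ i<j (≤-trans (proj₂ (in-ac j j∈)) (proj₁ (in-cb i i∈)))

    cell-at  : b < M → (t : Tree a b) → Segment t x y → suc x < y →
      ∃ λ S → S ∈ˡ cellsOf t × ∃₂ λ i j → toℕ i ≡ x × toℕ j ≡ y × Spans S i j
    cellᶠ-at : b < M → (f : Forest a b) → Segmentᶠ f x y → suc x < y →
      ∃ λ S → S ∈ˡ cellsOfᶠ f × ∃₂ λ i j → toℕ i ≡ x × toℕ j ≡ y × Spans S i j
    apart-at : b < M → (t : Tree a c) (f : Forest c b) → Segment t x y ⊎ Segmentᶠ f x y → suc x < y →
      ∃ λ S → S ∈ˡ cellsOf t ++ cellsOfᶠ f × ∃₂ λ i j → toℕ i ≡ x × toℕ j ≡ y × Spans S i j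
    cell-at b<M leaf (refl , refl) gap = ⊥-elim (<-irrefl refl gap)
    cell-at b<M (node t f) (inj₁ (refl , refl)) gap
      with vertexˡ∈ b<M (t ∷ f) | vertexʳ∈ b<M (t ∷ f)
    ... | i , refl , i∈ | j , refl , j∈ =
      _ , here refl , i , j , refl , refl , i∈ , j∈ , proj₁ (vertices-within b<M (t ∷ f))
    cell-at b<M (node t f) (inj₂ s) gap =
      let S , S∈ , rest = apart-at b<M t f s gap in S , there S∈ , rest
    cellᶠ-at b<M [ t ]   s gap = cell-at b<M t s gap
    cellᶠ-at b<M (t ∷ f) s gap = apart-at b<M t f s gap
    apart-at b<M t f (inj₁ s) gap =
      let S , S∈ , rest = cell-at (<-trans (forest-< f) b<M) t s gap in S , ∈-++⁺ˡ S∈ , rest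
    apart-at b<M t f (inj₂ s) gap =
      let S , S∈ , rest = cellᶠ-at b<M f s gap in S , ∈-++⁺ʳ (cellsOf t) S∈ , rest

    module _ (D : Dissection M) where

      open Represents
      open Representsᶠ

      tail-segment : (t : Tree a c) (f : Forest c b) → c ≤ x → Segment t x y ⊎ Segmentᶠ f x y → Segmentᶠ f x y
      tail-segment t f c≤x (inj₁ s) =
        let _ , x<y , y≤c = segment-≤ t s in ⊥-elim (<⇒≱ (<-≤-trans x<y y≤c) c≤x)
      tail-segment t f c≤x (inj₂ s) = s

      head-segment : (t : Tree a c) (f : Forest c b) → y ≤ c → Segment t x y ⊎ Segmentᶠ f x y → Segment t x y
      head-segment t f y≤c (inj₁ s) = s
      head-segment t f y≤c (inj₂ s) =
        let c≤x , x<y , _ = segmentᶠ-≤ f s in ⊥-elim (<⇒≱ (≤-<-trans c≤x x<y) y≤c)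

      treeOf-head : {t : Tree a c} {f : Forest c b} → IsTreeOf D (node t f) → IsTreeOf D t
      treeOf-head {t = t} {f} r = record
        { sound    = λ s → sound r (inj₂ (inj₁ s))
        ; complete = λ a≤x y≤c xy → go y≤c (complete r a≤x (≤-trans y≤c (<⇒≤ (forest-< f))) xy)
        }
        where
        go : y ≤ _ → Segment (node t f) x y → Segment t x y
        go y≤c (inj₁ (refl , refl)) = ⊥-elim (<⇒≱ (forest-< f) y≤c)
        go y≤c (inj₂ s) = head-segment t f y≤c s

      treeOf-tail : {t : Tree a c} {f : Forest c b} → IsTreeOf D (node t f) → IsForestOf D f
      treeOf-tail {t = t} {f} r = record
        { sound    = λ s → sound r (inj₂ (inj₂ s))
        ; complete = λ c≤x y≤b xy → go c≤x (complete r (≤-trans (<⇒≤ (tree-< t)) c≤x) y≤b xy)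
        }
        where
        go : _ ≤ x → Segment (node t f) x y → Segmentᶠ f x y
        go c≤x (inj₁ (refl , refl)) = ⊥-elim (<⇒≱ (tree-< t) c≤x)
        go c≤x (inj₂ s) = tail-segment t f c≤x s

      forestOf-head : {t : Tree a c} {f : Forest c b} → IsForestOf D (t ∷ f) → IsTreeOf D t
      forestOf-head {t = t} {f} r = record
        { sound    = λ s → sound r (inj₁ s)
        ; complete = λ a≤x y≤c xy →
            head-segment t f y≤c (complete r a≤x (≤-trans y≤c (<⇒≤ (forest-< f))) xy)
        }

      forestOf-tail : {t : Tree a c} {f : Forest c b} → IsForestOf D (t ∷ f) → IsForestOf D f
      forestOf-tail {t = t} {f} r = record
        { sound    = λ s → sound r (inj₂ s)
        ; complete = λ c≤x y≤b xy →
            tail-segment t f c≤x (complete r (≤-trans (<⇒≤ (tree-< t)) c≤x) y≤b xy)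
        }

      forestOf-single : {t : Tree a b} → IsForestOf D [ t ] → IsTreeOf D t
      forestOf-single r = record { sound = sound r ; complete = complete r }

      -- Consecutive vertices span the roots of the child trees, and the extreme ones span the root
      -- segment, so the sides are joined. Conversely a joined pair is, by completeness, the root
      -- segment or lies behind a single side, and then it has no vertex of the cell in between.
      node-isCell : b < M → (t : Tree a c) (f : Forest c b) → IsTreeOf D (node t f) →
        IsCell D (toSubset (vertices (t ∷ f)))
      node-isCell {b} {a} b<M t f r =
        subst (3 ≤_) (sym (∣vertices∣ b<M (t ∷ f))) (s≤s (vertices-length f)) ,
        λ i i∈ j j∈ i<j → side⇒joined i∈ j∈ i<j , joined⇒side i∈ j∈
        where
        S : Subset M
        S = toSubset (vertices (t ∷ f))
        member : ∀ {i} → i ∈ S → toℕ i ∈ˡ vertices (t ∷ f)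
        member = ∈-toSubset⁻ {w = vertices (t ∷ f)}
        bounds : ∀ {i} → i ∈ S → a ≤ toℕ i × toℕ i ≤ b
        bounds i∈ = vertices-≤ (t ∷ f) (member i∈)
        side⇒joined : ∀ {i j} → i ∈ S → j ∈ S → i Fin.< j → IsSide S i j → Joined D i j
        side⇒joined {i} {j} i∈ j∈ i<j (inj₁ none) = joinedN⇒joined D (sound r (inj₂
          (consecutive-segment (t ∷ f) (member i∈) (member j∈) i<j λ z z∈ (i<z , z<j) →
            let z<M = <-trans z<j (Fin.toℕ<n j)
                eq  = Fin.toℕ-fromℕ< z<M
            in  none (fromℕ< z<M) (∈-toSubset⁺ {w = vertices (t ∷ f)} (subst (_∈ˡ vertices (t ∷ f)) (sym eq) z∈))
                  (subst (toℕ i <_) (sym eq) i<z , subst (_< toℕ j) (sym eq) z<j))))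
        side⇒joined {i} {j} i∈ j∈ i<j (inj₂ all) with vertexˡ∈ b<M (t ∷ f) | vertexʳ∈ b<M (t ∷ f)
        ... | k , k≡a , k∈ | l , l≡b , l∈ = joinedN⇒joined D (sound r (inj₁
          ( ≤-antisym (subst (toℕ i ≤_) k≡a (proj₁ (all k k∈))) (proj₁ (bounds i∈))
          , ≤-antisym (proj₂ (bounds j∈)) (subst (_≤ toℕ j) l≡b (proj₂ (all l l∈))))))
        joined⇒side : ∀ {i j} → i ∈ S → j ∈ S → Joined D i j → IsSide S i j
        joined⇒side {i} {j} i∈ j∈ ij
          with complete r (proj₁ (bounds i∈)) (proj₂ (bounds j∈)) (joined⇒joinedN D ij)
        ... | inj₁ (i≡a , j≡b) = inj₂ λ k k∈ →
          subst (_≤ toℕ k) (sym i≡a) (proj₁ (bounds k∈)) , subst (toℕ k ≤_) (sym j≡b) (proj₂ (bounds k∈))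
        ... | inj₂ s = inj₁ λ k k∈ → segment-consecutive (t ∷ f) s (member k∈)

      cells-sound  : b < M → (t : Tree a b) → IsTreeOf D t → ∀ {S} → S ∈ˡ cellsOf t → IsCell D S
      cellsᶠ-sound : b < M → (f : Forest a b) → IsForestOf D f → ∀ {S} → S ∈ˡ cellsOfᶠ f → IsCell D S
      cells-sound b<M (node t f) r (here refl) = node-isCell b<M t f r
      cells-sound b<M (node t f) r (there p) with ∈-++⁻ (cellsOf t) p
      ... | inj₁ q = cells-sound (<-trans (forest-< f) b<M) t (treeOf-head r) q
      ... | inj₂ q = cellsᶠ-sound b<M f (treeOf-tail r) q
      cellsᶠ-sound b<M [ t ] r p = cells-sound b<M t (forestOf-single r) p
      cellsᶠ-sound b<M (t ∷ f) r p with ∈-++⁻ (cellsOf t) p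
      ... | inj₁ q = cells-sound (<-trans (forest-< f) b<M) t (forestOf-head r) q
      ... | inj₂ q = cellsᶠ-sound b<M f (forestOf-tail r) q

      module _ (t : Tree 0 (2 + n)) (r : IsTreeOf D t) where

        -- The closing side of `S` is a segment of the tree but not an edge between successors, so
        -- some node has a cell with the same extreme vertices, and this cell is `S`.
        cells-complete : ∀ {S} → IsCell D S → S ∈ˡ cellsOf t
        cells-complete {S} S-cell =
          let i , j , S-span , ij , gap = cell-span D {S} S-cell
              ij-segment = complete r z≤n (≤-pred (Fin.toℕ<n j)) (joined⇒joinedN D ij)
              S′ , S′∈ , i′ , j′ , i′≡i , j′≡j , S′-span = cell-at ≤-refl t ij-segment gap
          in  subst (_∈ˡ cellsOf t)
                (cell-unique D {S = S′} {S′ = S} (cells-sound ≤-refl t r {S′} S′∈) S-cell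
                  {i = i} {j = j} (spans-cong {S = S′} {i = i′} {j = j′} i′≡i j′≡j S′-span) S-span)
                S′∈

    occurrences-∈ : ∀ {w} → Unique w → α ∈ˡ w → occurrences w α ≡ 1
    occurrences-∉ : ∀ {w} → ¬ α ∈ˡ w → occurrences w α ≡ 0
    occurrences-∈ {α} (v∉w ∷ _) (here refl)
      rewrite δ-refl α = cong suc (occurrences-∉ λ p → All.lookup v∉w p refl)
    occurrences-∈ {α} (v∉w ∷ u) (there p)
      rewrite δ-≢ (λ v≡α → All.lookup v∉w p v≡α) = occurrences-∈ u p
    occurrences-∉ {w = []} _ = refl
    occurrences-∉ {w = v ∷ w} α∉
      rewrite δ-≢ (λ v≡α → α∉ (here (sym v≡α))) = occurrences-∉ (α∉ ∘ there)

    incident-cells  : ∀ (i : Fin M) (t : Tree a b) → incident i (cellsOf t) ≡ cellCount t (toℕ i)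
    incident-cellsᶠ : ∀ (i : Fin M) (f : Forest a b) → incident i (cellsOfᶠ f) ≡ cellCountᶠ f (toℕ i)
    incident-cells i leaf = refl
    incident-cells i (node t f)
      with i ∈? toSubset (vertices (t ∷ f))
    ... | yes p = cong₂ _+_ (sym (occurrences-∈ (vertices-unique (t ∷ f)) (∈-toSubset⁻ {w = vertices (t ∷ f)} p)))
      (trans (incident-++ i (cellsOf t) (cellsOfᶠ f)) (cong₂ _+_ (incident-cells i t) (incident-cellsᶠ i f)))
    ... | no ¬p = cong₂ _+_ (sym (occurrences-∉ (¬p ∘ ∈-toSubset⁺ {w = vertices (t ∷ f)})))
      (trans (incident-++ i (cellsOf t) (cellsOfᶠ f)) (cong₂ _+_ (incident-cells i t) (incident-cellsᶠ i f)))
    incident-cellsᶠ i [ t ] = incident-cells i t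
    incident-cellsᶠ i (t ∷ f) =
      trans (incident-++ i (cellsOf t) (cellsOfᶠ f)) (cong₂ _+_ (incident-cells i t) (incident-cellsᶠ i f))

    incidence≡cellCount : (D : Dissection M) (t : Tree 0 (2 + n)) → IsTreeOf D t →
      ∀ i → incidence D i ≡ cellCount t (toℕ i)
    incidence≡cellCount D t r i = trans
      (incidence≡incident D i (cellsOf t) (cells-unique ≤-refl t)
        (λ S → cells-complete D t r {S}) (λ S → cells-sound D ≤-refl t r {S}))
      (incident-cells i t)

    uniform-cells  : ∀ {k} → b < M → (t : Tree a b) → Uniform k t → ∀ {S} → S ∈ˡ cellsOf t → ∣ S ∣ ≡ k
    uniform-cellsᶠ : ∀ {k} → b < M → (f : Forest a b) → Uniformᶠ k f → ∀ {S} → S ∈ˡ cellsOfᶠ f → ∣ S ∣ ≡ k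
    uniform-cells b<M (node t f) (eq , _) (here refl) = trans (∣vertices∣ b<M (t ∷ f)) eq
    uniform-cells b<M (node t f) (_ , u , u′) (there p) with ∈-++⁻ (cellsOf t) p
    ... | inj₁ q = uniform-cells (<-trans (forest-< f) b<M) t u q
    ... | inj₂ q = uniform-cellsᶠ b<M f u′ q
    uniform-cellsᶠ b<M [ t ] u p = uniform-cells b<M t u p
    uniform-cellsᶠ b<M (t ∷ f) (u , u′) p with ∈-++⁻ (cellsOf t) p
    ... | inj₁ q = uniform-cells (<-trans (forest-< f) b<M) t u q
    ... | inj₂ q = uniform-cellsᶠ b<M f u′ q

    cells-uniform  : ∀ {k} → b < M → (t : Tree a b) → (∀ {S} → S ∈ˡ cellsOf t → ∣ S ∣ ≡ k) → Uniform k t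
    cellsᶠ-uniform : ∀ {k} → b < M → (f : Forest a b) → (∀ {S} → S ∈ˡ cellsOfᶠ f → ∣ S ∣ ≡ k) → Uniformᶠ k f
    cells-uniform b<M leaf h = tt
    cells-uniform b<M (node t f) h = trans (sym (∣vertices∣ b<M (t ∷ f))) (h (here refl)) ,
      cells-uniform (<-trans (forest-< f) b<M) t (λ p → h (there (∈-++⁺ˡ p))) ,
      cellsᶠ-uniform b<M f (λ p → h (there (∈-++⁺ʳ (cellsOf t) p)))
    cellsᶠ-uniform b<M [ t ] h = cells-uniform b<M t h
    cellsᶠ-uniform b<M (t ∷ f) h =
      cells-uniform (<-trans (forest-< f) b<M) t (λ p → h (∈-++⁺ˡ p)) ,
      cellsᶠ-uniform b<M f (λ p → h (∈-++⁺ʳ (cellsOf t) p))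

    angulation-uniform : ∀ {k} (D : Angulation k M) (t : Tree 0 (2 + n)) →
      IsTreeOf (dissection D) t → Uniform k t
    angulation-uniform D t r = cells-uniform ≤-refl t λ S∈ →
      cells D _ (cells-sound (dissection D) ≤-refl t r S∈)

    -- The segments of a tree include the edges of the polygon and the root, which have to be taken
    -- out.
    treeDissection : Tree 0 (2 + n) → Dissection M
    treeDissection t = record
      { Diag        = λ i j → (i Fin.< j × ¬ IsEdge i j) × Segment t (toℕ i) (toℕ j)
      ; diag?       = λ i j → ((i Fin.<? j) ×-dec ¬? (isEdge? i j)) ×-dec segment? t (toℕ i) (toℕ j)
      ; diagonal    = proj₁
      ; noncrossing = λ (_ , p) (_ , q) → segment-noncrossing t p q
      }

    treeDissection-tree : (t : Tree 0 (2 + n)) → IsTreeOf (treeDissection t) t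
    treeDissection-tree t = record { sound = sound′ ; complete = complete′ }
      where
      sound′ : Segment t x y → JoinedN (treeDissection t) x y
      sound′ {x} {y} s with segment-≤ t s
      ... | _ , x<y , y≤2+n = inj₂ (i , j , i≡x , j≡y , joined)
        where
        i j : Fin M
        i = fromℕ< (<-trans x<y (s≤s y≤2+n))
        j = fromℕ< (s≤s y≤2+n)
        i≡x : toℕ i ≡ x
        i≡x = Fin.toℕ-fromℕ< _
        j≡y : toℕ j ≡ y
        j≡y = Fin.toℕ-fromℕ< _
        joined : Joined (treeDissection t) i j
        joined with isEdge? i j
        ... | yes e = inj₁ e
        ... | no ¬e = inj₂ ((subst₂ _<_ (sym i≡x) (sym j≡y) x<y , ¬e) , subst₂ (Segment t) (sym i≡x) (sym j≡y) s)
      complete′ : 0 ≤ x → y ≤ 2 + n → JoinedN (treeDissection t) x y → Segment t x y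
      complete′ _ y≤ (inj₁ refl) = segment-edge t z≤n y≤
      complete′ _ y≤ (inj₂ (i , j , refl , refl , inj₁ (inj₁ j≡1+i))) =
        subst (Segment t _) (sym j≡1+i) (segment-edge t z≤n (subst (_≤ 2 + n) j≡1+i y≤))
      complete′ _ y≤ (inj₂ (i , j , refl , refl , inj₁ (inj₂ (i≡0 , 1+j≡M)))) =
        subst₂ (Segment t) (sym i≡0) (sym (suc-injective 1+j≡M)) (segment-root t)
      complete′ _ y≤ (inj₂ (i , j , refl , refl , inj₂ (_ , s))) = s

    treeAngulation : ∀ {k} (t : Tree 0 (2 + n)) → Uniform k t → Angulation k M
    treeAngulation t u = record
      { dissection = treeDissection t
      ; cells      = λ S S-cell →
          uniform-cells ≤-refl t u (cells-complete (treeDissection t) t (treeDissection-tree t) S-cell)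
      }

    tree-≐ : (D D′ : Dissection M) (t : Tree 0 (2 + n)) → IsTreeOf D t → IsTreeOf D′ t → D ≐ D′
    tree-≐ D D′ t r r′ i j = mk⇔ (transfer D D′ r r′) (transfer D′ D r′ r)
      where
      open Represents
      transfer : ∀ D D′ → IsTreeOf D t → IsTreeOf D′ t → Diag D i j → Diag D′ i j
      transfer D D′ r r′ ij with joinedN⇒joined D′ {i} {j}
        (sound r′ (complete r z≤n (≤-pred (Fin.toℕ<n j)) (joined⇒joinedN D (inj₂ ij))))
      ... | inj₁ edge = ⊥-elim (proj₂ (diagonal D ij) edge)
      ... | inj₂ diag = diag

    ≐-tree : (D D′ : Dissection M) {t : Tree 0 (2 + n)} → D ≐ D′ → IsTreeOf D t → IsTreeOf D′ t
    ≐-tree D D′ eq r = record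
      { sound    = λ s → transfer D D′ (λ {i} {j} → Equivalence.to (eq i j)) (Represents.sound r s)
      ; complete = λ p q xy → Represents.complete r p q (transfer D′ D (λ {i} {j} → Equivalence.from (eq i j)) xy)
      }
      where
      transfer : ∀ D D′ → (∀ {i j} → Diag D i j → Diag D′ i j) → JoinedN D x y → JoinedN D′ x y
      transfer D D′ h (inj₁ e) = inj₁ e
      transfer D D′ h (inj₂ (i , j , p , q , inj₁ e)) = inj₂ (i , j , p , q , inj₁ e)
      transfer D D′ h (inj₂ (i , j , p , q , inj₂ d)) = inj₂ (i , j , p , q , inj₂ (h d))

  -- Refinements

  module _ (h : ℕ) where

    -- The factor by which refining multiplies the number of cells at a vertex. The vertices of
    -- parity `ε` are the ones that get joined.
    weight : Parity → Parity → ℕ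
    weight 0ℙ 0ℙ = h
    weight 0ℙ 1ℙ = 1
    weight 1ℙ 0ℙ = 1
    weight 1ℙ 1ℙ = h

    weight-same : ∀ ε → weight ε ε ≡ h
    weight-same 0ℙ = refl
    weight-same 1ℙ = refl

    weight-opposite : ∀ ε → weight ε (ε ⁻¹) ≡ 1
    weight-opposite 0ℙ = refl
    weight-opposite 1ℙ = refl

    weight-* : ∀ ε p → weight ε p * weight ε (p ⁻¹) ≡ h
    weight-* 0ℙ 0ℙ = *-identityʳ h
    weight-* 0ℙ 1ℙ = *-identityˡ h
    weight-* 1ℙ 0ℙ = *-identityˡ h
    weight-* 1ℙ 1ℙ = *-identityʳ h

    -- The indicator vanishes unless `α` is `v`, so the weight may be read at the vertex of the
    -- cell, whose parity is known.
    weight-δ : ∀ ε v α → weight ε (parity α) * δ v α ≡ weight ε (parity v) * δ v α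
    weight-δ ε v α with v ≟ α
    ... | yes refl = refl
    ... | no  v≢α rewrite δ-≢ v≢α =
      trans (*-zeroʳ (weight ε (parity α))) (sym (*-zeroʳ (weight ε (parity v))))

    weight-δ-same : ∀ ε v α → parity v ≡ ε → weight ε (parity α) * δ v α ≡ h * δ v α
    weight-δ-same ε v α refl = trans (weight-δ ε v α) (cong (_* δ v α) (weight-same ε))

    weight-δ-opposite : ∀ ε v α → parity v ≡ ε ⁻¹ → weight ε (parity α) * δ v α ≡ δ v α
    weight-δ-opposite ε v α v≡ε⁻¹ = trans (weight-δ ε v α)
      (trans (cong (_* δ v α) (trans (cong (weight ε) v≡ε⁻¹) (weight-opposite ε))) (*-identityˡ _))

  same-or-opposite : ∀ ε p → p ≡ ε ⊎ p ≡ ε ⁻¹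
  same-or-opposite 0ℙ 0ℙ = inj₁ refl
  same-or-opposite 0ℙ 1ℙ = inj₂ refl
  same-or-opposite 1ℙ 0ℙ = inj₂ refl
  same-or-opposite 1ℙ 1ℙ = inj₁ refl

  parity-suc : ∀ m → parity (suc m) ≡ parity m ⁻¹
  parity-suc m = trans (sym (ℙ.⁻¹-involutive _)) (cong _⁻¹ (ℙ.suc-homo-⁻¹ m))

  -- h stands for λ².
  Refines : ℕ → Parity → Tree a b → Tri a b → Set
  Refines h ε t s = ∀ α → triCount s α ≡ weight h ε (parity α) * cellCount t α

  -- The induction carries along that a segment joins vertices of opposite parity: applied to the
  -- children, this makes the parities alternate along the vertices of the parent cell.
  Refinable : ℕ → Tree a b → Set
  Refinable {a} {b} h t = parity b ≡ parity a ⁻¹ × (∀ ε → ∃ (Refines h ε t))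

  leaf-refinable : ∀ h {a} → Refinable h (leaf {a})
  leaf-refinable h {a} = parity-suc a , λ ε → leaf , λ α → sym (*-zeroʳ (weight h ε (parity α)))

  flip : ∀ {p q ε} → p ≡ q ⁻¹ → q ≡ ε → p ≡ ε ⁻¹
  flip p≡q⁻¹ refl = p≡q⁻¹

  flip⁻¹ : ∀ {p q ε} → p ≡ q ⁻¹ → q ≡ ε ⁻¹ → p ≡ ε
  flip⁻¹ {ε = ε} p≡q⁻¹ refl = trans p≡q⁻¹ (ℙ.⁻¹-involutive ε)

  quad-refinable : (t : Tree a b) → Uniform 4 t → Refinable 2 t
  quad-refinable leaf _ = leaf-refinable 2
  quad-refinable (node t [ _ ]) (() , _)
  quad-refinable (node t (_ ∷ (_ ∷ [ _ ]))) (() , _)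
  quad-refinable (node t (_ ∷ (_ ∷ (_ ∷ [ _ ])))) (() , _)
  quad-refinable (node t (_ ∷ (_ ∷ (_ ∷ (_ ∷ _))))) (() , _)
  quad-refinable (node {a} {c₁} {b} t₁ (_∷_ {c = c₂} t₂ [ t₃ ])) (_ , u₁ , u₂ , u₃)
    with quad-refinable t₁ u₁ | quad-refinable t₂ u₂ | quad-refinable t₃ u₃
  ... | p₁ , r₁ | p₂ , r₂ | p₃ , r₃ = flip p₃ (flip⁻¹ p₂ p₁) , refine
    where
    refine : ∀ ε → ∃ (Refines 2 ε (node t₁ (t₂ ∷ [ t₃ ])))
    refine ε with r₁ ε | r₂ ε | r₃ ε | same-or-opposite ε (parity a)
    -- The vertices of parity `ε` are `a` and `c₂`: the diagonal joins them.
    ... | s₁ , e₁ | s₂ , e₂ | s₃ , e₃ | inj₁ p = node (node s₁ s₂) s₃ , count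
      where
      count : Refines 2 ε (node t₁ (t₂ ∷ [ t₃ ])) (node (node s₁ s₂) s₃)
      count α rewrite e₁ α | e₂ α | e₃ α = 
        quad-sum-even (weight 2 ε (parity α)) (δ a α) (δ c₁ α) (δ c₂ α) (δ b α)
          (cellCount t₁ α) (cellCount t₂ α) (cellCount t₃ α)
        (weight-δ-same 2 ε a α p) (weight-δ-opposite 2 ε c₁ α (flip p₁ p))
        (weight-δ-same 2 ε c₂ α (flip⁻¹ p₂ (flip p₁ p))) (weight-δ-opposite 2 ε b α (flip p₃ (flip⁻¹ p₂ (flip p₁ p))))
    -- The vertices of parity `ε` are `c₁` and `b`.
    ... | s₁ , e₁ | s₂ , e₂ | s₃ , e₃ | inj₂ p = node s₁ (node s₂ s₃) , count
      where
      count : Refines 2 ε (node t₁ (t₂ ∷ [ t₃ ])) (node s₁ (node s₂ s₃))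
      count α rewrite e₁ α | e₂ α | e₃ α = 
        quad-sum-odd (weight 2 ε (parity α)) (δ a α) (δ c₁ α) (δ c₂ α) (δ b α)
          (cellCount t₁ α) (cellCount t₂ α) (cellCount t₃ α)
        (weight-δ-opposite 2 ε a α p) (weight-δ-same 2 ε c₁ α (flip⁻¹ p₁ p))
        (weight-δ-opposite 2 ε c₂ α (flip p₂ (flip⁻¹ p₁ p))) (weight-δ-same 2 ε b α (flip⁻¹ p₃ (flip p₂ (flip⁻¹ p₁ p))))

  hex-refinable : (t : Tree a b) → Uniform 6 t → Refinable 3 t
  hex-refinable leaf _ = leaf-refinable 3
  hex-refinable (node t [ _ ]) (() , _)
  hex-refinable (node t (_ ∷ [ _ ])) (() , _)
  hex-refinable (node t (_ ∷ (_ ∷ [ _ ]))) (() , _)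
  hex-refinable (node t (_ ∷ (_ ∷ (_ ∷ (_ ∷ [ _ ]))))) (() , _)
  hex-refinable (node t (_ ∷ (_ ∷ (_ ∷ (_ ∷ (_ ∷ [ _ ])))))) (() , _)
  hex-refinable (node t (_ ∷ (_ ∷ (_ ∷ (_ ∷ (_ ∷ (_ ∷ _))))))) (() , _)
  hex-refinable (node {a} {c₁} {b} t₁ (_∷_ {c = c₂} t₂ (_∷_ {c = c₃} t₃ (_∷_ {c = c₄} t₄ [ t₅ ]))))
    (_ , u₁ , u₂ , u₃ , u₄ , u₅)
    with hex-refinable t₁ u₁ | hex-refinable t₂ u₂ | hex-refinable t₃ u₃ | hex-refinable t₄ u₄ | hex-refinable t₅ u₅
  ... | p₁ , r₁ | p₂ , r₂ | p₃ , r₃ | p₄ , r₄ | p₅ , r₅ =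
    flip p₅ (flip⁻¹ p₄ (flip p₃ (flip⁻¹ p₂ p₁))) , refine
    where
    t : Tree a b
    t = node t₁ (t₂ ∷ (t₃ ∷ (t₄ ∷ [ t₅ ])))
    refine : ∀ ε → ∃ (Refines 3 ε t)
    refine ε with r₁ ε | r₂ ε | r₃ ε | r₄ ε | r₅ ε | same-or-opposite ε (parity a)
    -- The central triangle is `a`, `c₂`, `c₄`.
    ... | s₁ , e₁ | s₂ , e₂ | s₃ , e₃ | s₄ , e₄ | s₅ , e₅ | inj₁ p = s , count
      where
      s : Tri a b
      s = node (node (node s₁ s₂) (node s₃ s₄)) s₅
      count : Refines 3 ε t s
      count α rewrite e₁ α | e₂ α | e₃ α | e₄ α | e₅ α =
        hex-sum-even (weight 3 ε (parity α)) (δ a α) (δ c₁ α) (δ c₂ α) (δ c₃ α) (δ c₄ α) (δ b α)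
          (cellCount t₁ α) (cellCount t₂ α) (cellCount t₃ α) (cellCount t₄ α) (cellCount t₅ α)
          (weight-δ-same 3 ε a α p) (weight-δ-opposite 3 ε c₁ α q₁)
          (weight-δ-same 3 ε c₂ α q₂) (weight-δ-opposite 3 ε c₃ α q₃)
          (weight-δ-same 3 ε c₄ α q₄) (weight-δ-opposite 3 ε b α (flip p₅ q₄))
        where
        q₁ = flip p₁ p
        q₂ = flip⁻¹ p₂ q₁
        q₃ = flip p₃ q₂
        q₄ = flip⁻¹ p₄ q₃
    -- The central triangle is `c₁`, `c₃`, `b`.
    ... | s₁ , e₁ | s₂ , e₂ | s₃ , e₃ | s₄ , e₄ | s₅ , e₅ | inj₂ p = s , count
      where
      s : Tri a b
      s = node s₁ (node (node s₂ s₃) (node s₄ s₅))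
      count : Refines 3 ε t s
      count α rewrite e₁ α | e₂ α | e₃ α | e₄ α | e₅ α =
        hex-sum-odd (weight 3 ε (parity α)) (δ a α) (δ c₁ α) (δ c₂ α) (δ c₃ α) (δ c₄ α) (δ b α)
          (cellCount t₁ α) (cellCount t₂ α) (cellCount t₃ α) (cellCount t₄ α) (cellCount t₅ α)
          (weight-δ-opposite 3 ε a α p) (weight-δ-same 3 ε c₁ α q₁)
          (weight-δ-opposite 3 ε c₂ α q₂) (weight-δ-same 3 ε c₃ α q₃)
          (weight-δ-opposite 3 ε c₄ α q₄) (weight-δ-same 3 ε b α (flip⁻¹ p₅ q₄))
        where
        q₁ = flip⁻¹ p₁ p
        q₂ = flip p₂ q₁
        q₃ = flip⁻¹ p₃ q₂
        q₄ = flip p₄ q₃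

  -- Neighbouring vertices that lie in a single cell

  Ear : ℕ → ℕ → (ℕ → ℕ) → Set
  Ear a b g = ∃ λ α → a < α × suc α < b × g α ≡ 1 × g (suc α) ≡ 1

  -- The two vertices of an ear lie strictly between the end points, where counts stay the same
  -- inside a larger tree. The first alternative is that of a leaf.
  TreeEar : Tree a b → Set
  TreeEar {a} {b} t = (b ≡ suc a × (∀ α → cellCount t α ≡ 0)) ⊎ Ear a b (cellCount t)

  -- Either all trees are leaves, and the vertices are then consecutive numbers, whence the equation
  -- for the length; or one tree has an ear, which avoids the vertices of the cell.
  ForestEar : Forest a b → Set
  ForestEar {a} {b} f =
    (suc b ≡ length (vertices f) + a
      × (∀ α → a ≤ α → α ≤ b → occurrences (vertices f) α ≡ 1) × (∀ α → cellCountᶠ f α ≡ 0))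
    ⊎ ∃ λ α → a < α × suc α < b
      × (occurrences (vertices f) α ≡ 0 × cellCountᶠ f α ≡ 1)
      × (occurrences (vertices f) (suc α) ≡ 0 × cellCountᶠ f (suc α) ≡ 1)

  single-ear : (t : Tree a b) → TreeEar t → ForestEar [ t ]
  single-ear {a} t (inj₁ (refl , zero-count)) = inj₁ (refl , once , zero-count)
    where
    once : ∀ α → a ≤ α → α ≤ suc a → occurrences (vertices [ t ]) α ≡ 1
    once α a≤α α≤1+a with m≤n⇒m<n∨m≡n a≤α
    ... | inj₂ refl rewrite δ-refl a | δ-≢ (>⇒≢ (n<1+n a)) = refl
    ... | inj₁ a<α with refl ← ≤-antisym α≤1+a a<α
      rewrite δ-≢ (<⇒≢ (n<1+n a)) | δ-refl (suc a) = refl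
  single-ear {a} {b} t (inj₂ (α , a<α , 1+α<b , p , q)) =
    inj₂ (α , a<α , 1+α<b , (none a<α (<-trans (n<1+n α) 1+α<b) , p) , (none (m<n⇒m<1+n a<α) 1+α<b , q))
    where
    none : ∀ {α} → a < α → α < b → occurrences (vertices [ t ]) α ≡ 0
    none a<α α<b rewrite δ-≢ (<⇒≢ a<α) | δ-≢ (>⇒≢ α<b) = refl

  cons-ear : (t : Tree a c) (f : Forest c b) → TreeEar t → ForestEar f → ForestEar (t ∷ f)
  cons-ear {a} {c} {b} t f (inj₁ (refl , zero-count)) (inj₁ (len , once , zero-countᶠ)) = inj₁
    ( trans len (+-suc _ a) , once′ , λ α → cong₂ _+_ (zero-count α) (zero-countᶠ α) )
    where
    once′ : ∀ α → a ≤ α → α ≤ b → occurrences (vertices (t ∷ f)) α ≡ 1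
    once′ α a≤α α≤b with m≤n⇒m<n∨m≡n a≤α
    ... | inj₂ refl rewrite δ-refl a = cong suc (occurrences-outside f (inj₁ (n<1+n a)))
    ... | inj₁ a<α  rewrite δ-≢ (<⇒≢ a<α) = once α a<α α≤b
  cons-ear {a} {c} t f (inj₂ (α , a<α , 1+α<c , p , q)) _ =
    inj₂ (α , a<α , <-trans 1+α<c (forest-< f) , both a<α (<-trans (n<1+n α) 1+α<c) p , both (m<n⇒m<1+n a<α) 1+α<c q)
    where
    both : ∀ {α} → a < α → α < c → cellCount t α ≡ 1 →
      occurrences (vertices (t ∷ f)) α ≡ 0 × cellCountᶠ (t ∷ f) α ≡ 1
    both a<α α<c eq rewrite δ-≢ (<⇒≢ a<α) | eq =
      occurrences-outside f (inj₁ α<c) , cong suc (cellCountᶠ-outside f (inj₁ α<c))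
  cons-ear {a} {c} t f (inj₁ _) (inj₂ (α , c<α , 1+α<b , p , q)) =
    inj₂ (α , <-trans (tree-< t) c<α , 1+α<b , both c<α p , both (m<n⇒m<1+n c<α) q)
    where
    both : ∀ {α} → c < α → occurrences (vertices f) α ≡ 0 × cellCountᶠ f α ≡ 1 →
      occurrences (vertices (t ∷ f)) α ≡ 0 × cellCountᶠ (t ∷ f) α ≡ 1
    both c<α (p , q)
      rewrite δ-≢ (<⇒≢ (<-trans (tree-< t) c<α)) | cellCount-outside t (inj₂ c<α) = p , q

  -- If all children are leaves, the cell has the consecutive vertices `a` to `b`. As there are at
  -- least four, `suc a` and `2 + a` lie strictly inside, and this cell is their only one.
  node-ear : ∀ {k} → 4 ≤ k → (t : Tree a c) (f : Forest c b) → length (vertices (t ∷ f)) ≡ k →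
    ForestEar (t ∷ f) → Ear a b (cellCount (node t f))
  node-ear {a} {b = b} 4≤k t f refl (inj₁ (len , once , zero-count)) =
    suc a , n<1+n a , 2+a<b , at (suc a) (n≤1+n a) (<⇒≤ (<-trans (n<1+n _) 2+a<b)) ,
    at (2 + a) (m≤n+m a 2) (<⇒≤ 2+a<b)
    where
    2+a<b : 2 + a < b
    2+a<b = ≤-pred (subst (4 + a ≤_) (sym len) (+-monoˡ-≤ a 4≤k))
    at : ∀ α → a ≤ α → α ≤ b → cellCount (node t f) α ≡ 1
    at α a≤α α≤b = cong₂ _+_ (once α a≤α α≤b) (zero-count α)
  node-ear 4≤k t f _ (inj₂ (α , a<α , 1+α<b , (p , p′) , (q , q′))) =
    α , a<α , 1+α<b , cong₂ _+_ p p′ , cong₂ _+_ q q′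

  tree-ear   : ∀ {k} → 4 ≤ k → (t : Tree a b) → Uniform k t → TreeEar t
  forest-ear : ∀ {k} → 4 ≤ k → (f : Forest a b) → Uniformᶠ k f → ForestEar f
  tree-ear 4≤k leaf _ = inj₁ (refl , λ _ → refl)
  tree-ear 4≤k (node t f) (len , u , u′) =
    inj₂ (node-ear 4≤k t f len (cons-ear t f (tree-ear 4≤k t u) (forest-ear 4≤k f u′)))
  forest-ear 4≤k [ t ] u = single-ear t (tree-ear 4≤k t u)
  forest-ear 4≤k (t ∷ f) (u , u′) = cons-ear t f (tree-ear 4≤k t u) (forest-ear 4≤k f u′)

  cellCount-positive : (t : Tree a b) → a < α → α < b → 0 < cellCount t α
  forest-positive : (f : Forest a b) → a ≤ α → α ≤ b → 0 < occurrences (vertices f) α + cellCountᶠ f α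
  node-positive : (t : Tree a c) (f : Forest c b) → a ≤ α → α ≤ b → 0 < cellCount (node t f) α
  cellCount-positive leaf a<α α<b = ⊥-elim (<⇒≱ a<α (≤-pred α<b))
  cellCount-positive (node t f) a<α α<b = node-positive t f (<⇒≤ a<α) (<⇒≤ α<b)
  forest-positive {a} {b} [ t ] a≤α α≤b with m≤n⇒m<n∨m≡n a≤α | m≤n⇒m<n∨m≡n α≤b
  ... | inj₂ refl | _         rewrite δ-refl a = z<s
  ... | inj₁ a<α  | inj₂ refl rewrite δ-refl b | δ-≢ (<⇒≢ a<α) = z<s
  ... | inj₁ a<α  | inj₁ α<b  = <-≤-trans (cellCount-positive t a<α α<b) (m≤n+m _ _)
  forest-positive (t ∷ f) a≤α α≤b = node-positive t f a≤α α≤b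
  node-positive {a} {c} {α = α} t f a≤α α≤b with m≤n⇒m<n∨m≡n a≤α | α <? c
  ... | inj₂ refl | _       rewrite δ-refl a = z<s
  ... | inj₁ a<α  | yes α<c = <-≤-trans (cellCount-positive t a<α α<c)
    (≤-trans (m≤m+n _ (cellCountᶠ f α)) (m≤n+m _ (occurrences (vertices (t ∷ f)) α)))
  ... | inj₁ a<α  | no  α≮c = <-≤-trans (forest-positive f (≮⇒≥ α≮c) α≤b)
    (+-mono-≤ (m≤n+m _ (δ a α)) (m≤n+m _ (cellCount t α)))

  -- Sequences with equal products of neighbours

  agreement-up : ∀ {g e : ℕ → ℕ} {N} → (∀ i → i ≤ N → 0 < e i) →
    (∀ i → i < N → g i * g (suc i) ≡ e i * e (suc i)) →
    ∀ {α} k → k + α ≤ N → g α ≡ e α → g (k + α) ≡ e (k + α)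
  agreement-up e>0 eq zero _ p = p
  agreement-up {g} {e} e>0 eq {α} (suc k) k+α<N p = *-cancelˡ-≡ _ _ (e (k + α)) {{>-nonZero (e>0 _ (<⇒≤ k+α<N))}}
    (trans (cong (_* g (suc (k + α))) (sym (agreement-up {g} {e} e>0 eq k (<⇒≤ k+α<N) p))) (eq _ k+α<N))

  agreement-down : ∀ {g e : ℕ → ℕ} {N} → (∀ i → i ≤ N → 0 < e i) →
    (∀ i → i < N → g i * g (suc i) ≡ e i * e (suc i)) →
    ∀ {α} k → k + α ≤ N → g (k + α) ≡ e (k + α) → g α ≡ e α
  agreement-down e>0 eq zero _ p = p
  agreement-down {g} {e} e>0 eq {α} (suc k) k+α<N p =
    agreement-down {g} {e} e>0 eq k (<⇒≤ k+α<N)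
      (*-cancelʳ-≡ _ _ (e (suc (k + α))) {{>-nonZero (e>0 _ k+α<N)}}
        (trans (cong (g (k + α) *_) (sym p)) (eq _ k+α<N)))

  -- A common value at `α` spreads in both directions: in equal products of neighbours, the equal
  -- positive factor cancels.
  agreement : ∀ {g e : ℕ → ℕ} {N} → (∀ i → i ≤ N → 0 < e i) →
    (∀ i → i < N → g i * g (suc i) ≡ e i * e (suc i)) →
    ∀ {α} → α ≤ N → g α ≡ e α → ∀ {i} → i ≤ N → g i ≡ e i
  agreement {g} {e} {N} e>0 eq {α} α≤N p {i} i≤N with ≤-total α i
  ... | inj₁ α≤i = subst (λ j → g j ≡ e j) (m∸n+n≡m α≤i)
    (agreement-up {g} {e} e>0 eq (i ∸ α) (subst (_≤ N) (sym (m∸n+n≡m α≤i)) i≤N) p)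
  ... | inj₂ i≤α = agreement-down {g} {e} e>0 eq (α ∸ i) (subst (_≤ N) (sym (m∸n+n≡m i≤α)) α≤N)
    (subst (λ j → g j ≡ e j) (sym (m∸n+n≡m i≤α)) p)

  -- The two refinements of an angulation

  module Refinement {h k n} (h-prime : Prime h) (4≤k : 4 ≤ k)
    (refinable : ∀ {a b} (t : Tree a b) → Uniform k t → Refinable h t) (D : Angulation k (3 + n)) where

    private
      opaque
        t : Tree 0 (2 + n)
        t = proj₁ (dissectionTree (dissection D))

        t-tree : IsTreeOf (dissection D) t
        t-tree = proj₂ (dissectionTree (dissection D))

      t-uniform : Uniform k t
      t-uniform = angulation-uniform D t t-tree

      opaque
        s : Parity → Tri 0 (2 + n)
        s ε = proj₁ (proj₂ (refinable t t-uniform) ε)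

        s-count : ∀ ε → Refines h ε t (s ε)
        s-count ε = proj₂ (proj₂ (refinable t t-uniform) ε)

      incidence-t : ∀ i → incidence (dissection D) i ≡ cellCount t (toℕ i)
      incidence-t = incidence≡cellCount (dissection D) t t-tree

      ear : Ear 0 (2 + n) (cellCount t)
      ear with tree-ear 4≤k t t-uniform
      ... | inj₁ (() , _)
      ... | inj₂ e = e

      t-positive : ∀ i → i ≤ 2 + n → 0 < cellCount t i
      t-positive = root-positive t
        where
        root-positive : (t : Tree 0 (2 + n)) → ∀ i → i ≤ 2 + n → 0 < cellCount t i
        root-positive (node t f) i i≤ = node-positive t f z≤n i≤

    -- The root segment joins 0 to a vertex of the opposite parity. So `n` is odd, and the polygon
    -- has an even number of vertices, whose parity is thereby compatible with going round.
    parity-2+n : parity (2 + n) ≡ 1ℙ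
    parity-2+n = proj₁ (refinable t t-uniform)

    refinement : Parity → Triangulation (3 + n)
    refinement ε = treeAngulation ⟦ s ε ⟧ (⟦⟧-uniform (s ε))

    private
      refinement-tree : ∀ ε → IsTreeOf (dissection (refinement ε)) ⟦ s ε ⟧
      refinement-tree ε = treeDissection-tree ⟦ s ε ⟧

      incidence-s : ∀ ε i → incidence (dissection (refinement ε)) i ≡ triCount (s ε) (toℕ i)
      incidence-s ε = incidence≡cellCount (dissection (refinement ε)) ⟦ s ε ⟧ (refinement-tree ε)

    refinement-incidence : ∀ ε i → incidence (dissection (refinement ε)) i ≡
      weight h ε (parity (toℕ i)) * incidence (dissection D) i
    refinement-incidence ε i = trans (incidence-s ε i)
      (trans (s-count ε (toℕ i)) (cong (weight h ε (parity (toℕ i)) *_) (sym (incidence-t i))))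

    private
      count-at-ear : ∀ ε {α} → cellCount t α ≡ 1 → triCount (s ε) α ≡ weight h ε (parity α)
      count-at-ear ε {α} eq = trans (s-count ε α)
        (trans (cong (weight h ε (parity α) *_) eq) (*-identityʳ _))

      h≢1 : h ≢ 1
      h≢1 refl = ¬prime[1] h-prime

    -- At a vertex of an ear the counts of the refinements are the bare weights, `h` for one and 1
    -- for the other. Equal dissections would be represented by the same tree and have equal counts.
    refinement-distinct : ¬ (dissection (refinement 0ℙ) ≐ dissection (refinement 1ℙ))
    refinement-distinct eq with ear
    ... | α , _ , 1+α<2+n , eq-α , _ = weights-differ (parity α) (begin
      weight h 0ℙ (parity α)  ≡⟨ count-at-ear 0ℙ eq-α ⟨
      triCount (s 0ℙ) α       ≡⟨ cong (triCount (s 0ℙ)) i≡α ⟨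
      triCount (s 0ℙ) (toℕ i) ≡⟨ incidence≡cellCount (dissection (refinement 1ℙ)) ⟦ s 0ℙ ⟧
                                   (≐-tree (dissection (refinement 0ℙ)) (dissection (refinement 1ℙ)) eq (refinement-tree 0ℙ)) i ⟨
      incidence (dissection (refinement 1ℙ)) i ≡⟨ incidence-s 1ℙ i ⟩
      triCount (s 1ℙ) (toℕ i) ≡⟨ cong (triCount (s 1ℙ)) i≡α ⟩
      triCount (s 1ℙ) α       ≡⟨ count-at-ear 1ℙ eq-α ⟩
      weight h 1ℙ (parity α)  ∎)
      where
      open ≡-Reasoning
      α<3+n : α < 3 + n
      α<3+n = <-trans (n<1+n α) (<-trans 1+α<2+n (n<1+n _))
      i : Fin (3 + n)
      i = fromℕ< α<3+n
      i≡α : toℕ i ≡ α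
      i≡α = Fin.toℕ-fromℕ< α<3+n
      weights-differ : ∀ p → weight h 0ℙ p ≢ weight h 1ℙ p
      weights-differ 0ℙ = h≢1
      weights-differ 1ℙ = h≢1 ∘ sym

    private
      s-products : ∀ ε i → triCount (s ε) i * triCount (s ε) (suc i) ≡ h * (cellCount t i * cellCount t (suc i))
      s-products ε i = begin
        triCount (s ε) i * triCount (s ε) (suc i)
          ≡⟨ cong₂ _*_ (s-count ε i) (s-count ε (suc i)) ⟩
        (weight h ε (parity i) * cellCount t i) * (weight h ε (parity (suc i)) * cellCount t (suc i))
          ≡⟨ [m*n]*[o*p]≡[m*o]*[n*p] (weight h ε (parity i)) _ _ _ ⟩
        (weight h ε (parity i) * weight h ε (parity (suc i))) * (cellCount t i * cellCount t (suc i))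
          ≡⟨ cong (_* (cellCount t i * cellCount t (suc i)))
               (trans (cong (λ p → weight h ε (parity i) * weight h ε p) (parity-suc i)) (weight-* h ε (parity i))) ⟩
        h * (cellCount t i * cellCount t (suc i)) ∎
        where open ≡-Reasoning

      s-positive : ∀ ε i → i ≤ 2 + n → 0 < triCount (s ε) i
      s-positive ε i i≤ = subst (0 <_) (sym (s-count ε i))
        (>-nonZero⁻¹ _ {{m*n≢0 _ _ {{weight≢0 ε (parity i)}} {{>-nonZero (t-positive i i≤)}}}})
        where
        weight≢0 : ∀ ε p → NonZero (weight h ε p)
        weight≢0 0ℙ 0ℙ = prime⇒nonZero h-prime
        weight≢0 0ℙ 1ℙ = _
        weight≢0 1ℙ 0ℙ = _
        weight≢0 1ℙ 1ℙ = prime⇒nonZero h-prime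

      module _ (τ : Tri 0 (2 + n))
        (products : ∀ i → i < 2 + n →
          triCount τ i * triCount τ (suc i) ≡ h * (cellCount t i * cellCount t (suc i))) where

        τ-count : ∀ ε {α} → α ≤ 2 + n → triCount τ α ≡ triCount (s ε) α → ∀ i → triCount τ i ≡ triCount (s ε) i
        τ-count ε α≤ eq i with i ≤? 2 + n
        ... | yes i≤ = agreement {triCount τ} {triCount (s ε)} (s-positive ε)
          (λ j j< → trans (products j j<) (sym (s-products ε j))) α≤ eq i≤
        -- Beyond the last vertex both counts are zero; `triCount-injective` compares them at every
        -- natural number.
        ... | no i≰ = trans (cellCount-outside ⟦ τ ⟧ (inj₂ (≰⇒> i≰)))
          (sym (cellCount-outside ⟦ s ε ⟧ (inj₂ (≰⇒> i≰))))

        τ-unique : ∃ λ ε → τ ≡ s ε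
        τ-unique with ear
        ... | α , _ , 1+α<2+n , eq , eq′ with prime⇒irreducible h-prime τ∣h
          where
          τ∣h : triCount τ α ∣ h
          τ∣h = divides (triCount τ (suc α)) (begin
            h                                       ≡⟨ *-identityʳ h ⟨
            h * 1                                   ≡⟨ cong (h *_) (cong₂ _*_ eq eq′) ⟨
            h * (cellCount t α * cellCount t (suc α)) ≡⟨ products α (<-trans (n<1+n α) 1+α<2+n) ⟨
            triCount τ α * triCount τ (suc α)                         ≡⟨ *-comm (triCount τ α) _ ⟩
            triCount τ (suc α) * triCount τ α                         ∎)
            where open ≡-Reasoning
        -- Count 1 at `α` means that the joined vertices are those of the parity opposite to `α`; in
        -- the other case, count `h`, those of its own parity.
        ...   | inj₁ τ≡1 = parity α ⁻¹ , triCount-injective (τ-count (parity α ⁻¹) (<⇒≤ (<-trans (n<1+n α) 1+α<2+n))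
          (trans τ≡1 (sym (trans (count-at-ear (parity α ⁻¹) eq)
            (trans (cong (weight h (parity α ⁻¹)) (sym (ℙ.⁻¹-involutive (parity α)))) (weight-opposite h (parity α ⁻¹)))))))
        ...   | inj₂ τ≡h = parity α , triCount-injective (τ-count (parity α) (<⇒≤ (<-trans (n<1+n α) 1+α<2+n))
          (trans τ≡h (sym (trans (count-at-ear (parity α) eq) (weight-same h (parity α))))))

    refinement-unique : (T : Triangulation (3 + n)) →
      (∀ i (i<2+n : i < 2 + n) → let j = fromℕ< (m<n⇒m<1+n i<2+n); j′ = fromℕ< (s≤s i<2+n) in
        incidence (dissection T) j * incidence (dissection T) j′ ≡
        h * (incidence (dissection D) j * incidence (dissection D) j′)) →
      ∃ λ ε → dissection T ≐ dissection (refinement ε)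
    refinement-unique T products =
      let ε , τ≡s = τ-unique τ τ-products
      in  ε , tree-≐ (dissection T) (dissection (refinement ε)) ⟦ s ε ⟧
                (subst (λ w → IsTreeOf (dissection T) ⟦ w ⟧) τ≡s (proj₂ T-tree)) (refinement-tree ε)
      where
      opaque
        T-tree : ∃ λ (τ : Tri 0 (2 + n)) → IsTreeOf (dissection T) ⟦ τ ⟧
        T-tree =
          let w , r  = dissectionTree (dissection T)
              τ , eq = uniform⇒⟦⟧ w (angulation-uniform T w r)
          in  τ , subst (IsTreeOf (dissection T)) (sym eq) r

      τ : Tri 0 (2 + n)
      τ = proj₁ T-tree
      incidence-τ : ∀ i → incidence (dissection T) i ≡ triCount τ (toℕ i)
      incidence-τ = incidence≡cellCount (dissection T) ⟦ τ ⟧ (proj₂ T-tree)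
      τ-products : ∀ i → i < 2 + n → triCount τ i * triCount τ (suc i) ≡ h * (cellCount t i * cellCount t (suc i))
      τ-products i i<2+n = subst₂ (λ x y → triCount τ x * triCount τ y ≡ h * (cellCount t x * cellCount t y))
        (Fin.toℕ-fromℕ< (m<n⇒m<1+n i<2+n)) (Fin.toℕ-fromℕ< (s≤s i<2+n))
        (trans (sym (cong₂ _*_ (incidence-τ _) (incidence-τ _)))
          (trans (products i i<2+n) (cong (h *_) (cong₂ _*_ (incidence-t _) (incidence-t _)))))

open Combinatorics using
  (Tree; Uniform; Refinable; weight; parity-suc; quad-refinable; hex-refinable; module Refinement)

-- Real numbers

module RealProperties {c ℓ₁ ℓ₂} (ℝ : RealNumbers c ℓ₁ ℓ₂) where
  open RealNumbers ℝ

  module R = CommutativeRing commutativeRing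
  open Algebra.Properties.Ring R.ring using (-0#≈0#; -‿distribʳ-*; x∙y⁻¹≈ε⇒x≈y)
  open Algebra.Properties.Semiring.Mult R.semiring using (×1-homo-*; ×-homo-+; ×-congˡ)
  module <ᵣ = IsStrictPartialOrder isStrictPartialOrder
  open Algebra.Solver.Ring.NaturalCoefficients.Default R.commutativeSemiring
    using (solve; _:=_; _:+_; _:*_; con)
  open Relation.Binary.Reasoning.Setoid R.setoid

  <-resp : ∀ {x x′ y y′} → x ≈ x′ → y ≈ y′ → x < y → x′ < y′
  <-resp p q x<y = <ᵣ.<-respˡ-≈ p (<ᵣ.<-respʳ-≈ q x<y)

  x-0≈x : ∀ x → x - 0# ≈ x
  x-0≈x x = R.trans (R.+-congˡ -0#≈0#) (R.+-identityʳ x)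

  x<x+y : ∀ {x y} → 0# < y → x < x + y
  x<x+y {x} {y} 0<y = <-resp (R.+-identityˡ x) (R.+-comm y x) (+-monoˡ-< x 0<y)

  positive⇒invertible : ∀ {x} → 0# < x → ∃ λ y → x * y ≈ 1#
  positive⇒invertible {x} 0<x =
    let y , _ , xy≈1 = #⇒invertible (#-sym (<⇒# 0<x))
    in  y , R.trans (R.*-congʳ (R.sym (x-0≈x x))) xy≈1

  -- Being invertible, `y` is apart from zero. If it were negative, the product of `x` and `- y`
  -- would make `- 1#` positive.
  inverse-positive : ∀ {x y} → 0# < x → x * y ≈ 1# → 0# < y
  inverse-positive {x} {y} 0<x xy≈1
    with #⇒<⊎> (invertible⇒# {y} {0#} (x , R.trans (R.*-congˡ (x-0≈x y)) xy≈1
                                         , R.trans (R.*-congʳ (x-0≈x y)) (R.trans (R.*-comm y x) xy≈1)))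
  ... | inj₂ 0<y = 0<y
  ... | inj₁ y<0 = ⊥-elim (<ᵣ.irrefl R.refl (<ᵣ.trans 0<-1 -1<0))
    where
    0<-y : 0# < - y
    0<-y = <-resp (R.-‿inverseʳ y) (R.+-identityˡ (- y)) (+-monoˡ-< (- y) y<0)
    0<-1 : 0# < - 1#
    0<-1 = <-resp R.refl (R.trans (R.sym (-‿distribʳ-* x y)) (R.-‿cong xy≈1)) (*-positive 0<x 0<-y)
    -1<0 : - 1# < 0#
    -1<0 = <-resp (R.+-identityˡ (- 1#)) (R.-‿inverseʳ 1#) (+-monoˡ-< (- 1#) 0<1)

  *-cancelˡ : ∀ {x y z} → 0# < x → x * y ≈ x * z → y ≈ z
  *-cancelˡ {x} {y} {z} 0<x xy≈xz with positive⇒invertible 0<x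
  ... | x⁻¹ , xx⁻¹≈1 = begin
    y             ≈⟨ R.*-identityˡ y ⟨
    1# * y        ≈⟨ R.*-congʳ (R.trans (R.*-comm x⁻¹ x) xx⁻¹≈1) ⟨
    (x⁻¹ * x) * y ≈⟨ R.*-assoc x⁻¹ x y ⟩
    x⁻¹ * (x * y) ≈⟨ R.*-congˡ xy≈xz ⟩
    x⁻¹ * (x * z) ≈⟨ R.*-assoc x⁻¹ x z ⟨
    (x⁻¹ * x) * z ≈⟨ R.*-congʳ (R.trans (R.*-comm x⁻¹ x) xx⁻¹≈1) ⟩
    1# * z        ≈⟨ R.*-identityˡ z ⟩
    z ∎

  fromℕ-* : ∀ m n → fromℕ (m ℕ.* n) ≈ fromℕ m * fromℕ n
  fromℕ-* = ×1-homo-*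

  fromℕ-1 : fromℕ 1 ≈ 1#
  fromℕ-1 = R.+-identityʳ 1#

  fromℕ-< : ∀ {m n} → m ℕ.< n → fromℕ m < fromℕ n
  fromℕ-< {m} m<n with ℕ.m≤n⇒∃[o]m+o≡n m<n
  ... | k , ≡.refl = <-resp R.refl
    (R.trans (R.sym (×-homo-+ 1# m (suc k))) (×-congˡ (ℕ.+-suc m k))) (x<x+y (fromℕ-positive k))

  -- This brings the products of quiddity entries back from the reals to natural numbers, where
  -- primality applies.
  fromℕ-injective : ∀ {m n} → fromℕ m ≈ fromℕ n → m ≡ n
  fromℕ-injective {m} {n} eq with ℕ.<-cmp m n
  ... | tri< m<n _ _ = ⊥-elim (<ᵣ.irrefl eq (fromℕ-< m<n))
  ... | tri≈ _ m≡n _ = m≡n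
  ... | tri> _ _ n<m = ⊥-elim (<ᵣ.irrefl (R.sym eq) (fromℕ-< n<m))

  -‿≈⇒≈+ : ∀ {x y z} → x - y ≈ z → x ≈ z + y
  -‿≈⇒≈+ {x} {y} {z} eq = begin
    x             ≈⟨ R.+-identityʳ x ⟨
    x + 0#        ≈⟨ R.+-congˡ (R.-‿inverseˡ y) ⟨
    x + (- y + y) ≈⟨ R.+-assoc x (- y) y ⟨
    x - y + y     ≈⟨ R.+-congʳ eq ⟩
    z + y ∎

  x-y≈0⇒x≈y : ∀ {x y} → x - y ≈ 0# → x ≈ y
  x-y≈0⇒x≈y {x} {y} = x∙y⁻¹≈ε⇒x≈y x y

  /-* : ∀ x m n k .{{_ : NonZero n}} .{{_ : NonZero k}} → k ≡ n ℕ.* m → fromℕ m * (x / k) ≈ x / n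
  /-* x m n@(suc n′) k ≡.refl = *-cancelˡ (fromℕ-positive n′) (begin
    fromℕ n * (fromℕ m * (x * k⁻¹))  ≈⟨ solve 4 (λ a b x y → a :* (b :* (x :* y)) := x :* ((a :* b) :* y)) R.refl (fromℕ n) (fromℕ m) x k⁻¹ ⟩
    x * ((fromℕ n * fromℕ m) * k⁻¹)  ≈⟨ R.*-congˡ (R.*-congʳ (fromℕ-* n m)) ⟨
    x * (fromℕ k * k⁻¹)              ≈⟨ R.*-congˡ (R.trans (proj₂ (fromℕ-invertible k)) (R.sym (proj₂ (fromℕ-invertible n)))) ⟩
    x * (fromℕ n * n⁻¹)              ≈⟨ solve 3 (λ a x y → x :* (a :* y) := a :* (x :* y)) R.refl (fromℕ n) x n⁻¹ ⟩
    fromℕ n * (x * n⁻¹) ∎)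
    where
    k⁻¹ = proj₁ (fromℕ-invertible k)
    n⁻¹ = proj₁ (fromℕ-invertible n)

  /-positive : ∀ {x} n .{{_ : NonZero n}} → 0# < x → 0# < x / n
  /-positive n@(suc n′) 0<x =
    *-positive 0<x (inverse-positive (fromℕ-positive n′) (proj₂ (fromℕ-invertible n)))

  -- The values of `λ` for 3, 4 and 6

  module Angles (trig : Trigonometry ℝ) where
    open Trigonometry trig
    open Friezes ℝ trig using (λ[_])

    private
      fromℕ-2 : fromℕ 2 ≈ 1# + 1#
      fromℕ-2 = R.+-congˡ (R.+-identityʳ 1#)

      fromℕ-3 : fromℕ 3 ≈ 1# + 1# + 1#
      fromℕ-3 = R.trans (R.+-congˡ fromℕ-2) (R.sym (R.+-assoc 1# 1# 1#))

      two-* : ∀ x → fromℕ 2 * x ≈ x + x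
      two-* x = R.trans (R.*-congʳ fromℕ-2) (solve 1 (λ x → con 2 :* x := x :+ x) R.refl x)

      three-* : ∀ x → fromℕ 3 * x ≈ x + x + x
      three-* x = R.trans (R.*-congʳ fromℕ-3) (solve 1 (λ x → con 3 :* x := x :+ x :+ x) R.refl x)

      double-square : ∀ x → (fromℕ 2 * x) * (fromℕ 2 * x) ≈ fromℕ 2 * (x * x + x * x)
      double-square x = R.trans (R.*-congˡ (two-* x))
        (solve 2 (λ t x → (t :* x) :* (x :+ x) := t :* (x :* x :+ x :* x)) R.refl (fromℕ 2) x)

    π/4+π/4 : π / 4 + π / 4 ≈ π / 2
    π/4+π/4 = R.trans (R.sym (two-* _)) (/-* π 2 2 4 ≡.refl)

    π/6+π/6+π/6 : π / 6 + π / 6 + π / 6 ≈ π / 2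
    π/6+π/6+π/6 = R.trans (R.sym (three-* _)) (/-* π 3 2 6 ≡.refl)

    π/6+π/6 : π / 6 + π / 6 ≈ π / 3
    π/6+π/6 = R.trans (R.sym (two-* _)) (/-* π 2 3 6 ≡.refl)

    cos-positive : ∀ k .{{_ : NonZero k}} → π / k < π / 2 → 0# < cos (π / k)
    cos-positive k = cos>0 _ (/-positive k 0<π)

    π/4<π/2 : π / 4 < π / 2
    π/4<π/2 = <-resp R.refl π/4+π/4 (x<x+y (/-positive 4 0<π))

    π/6<π/2 : π / 6 < π / 2
    π/6<π/2 = <-resp R.refl π/6+π/6+π/6 (<ᵣ.trans (x<x+y 0<π/6) (x<x+y 0<π/6))
      where
      0<π/6 : 0# < π / 6
      0<π/6 = /-positive 6 0<π

    λ-positive : ∀ k .{{_ : NonZero k}} → π / k < π / 2 → 0# < λ[ k ]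
    λ-positive k p = *-positive (fromℕ-positive 1) (cos-positive k p)

    λ₄-positive : 0# < λ[ 4 ]
    λ₄-positive = λ-positive 4 π/4<π/2

    λ₆-positive : 0# < λ[ 6 ]
    λ₆-positive = λ-positive 6 π/6<π/2

    -- The addition formula at `π / 2`, where the cosine vanishes, makes the squares of cosine and
    -- sine equal at `π / 4`; their sum is 1.
    λ₄² : λ[ 4 ] * λ[ 4 ] ≈ fromℕ 2
    λ₄² = begin
      λ[ 4 ] * λ[ 4 ]         ≈⟨ double-square C ⟩
      fromℕ 2 * (C * C + C * C) ≈⟨ R.*-congˡ (R.+-congˡ C²≈S²) ⟩
      fromℕ 2 * (C * C + S * S) ≈⟨ R.*-congˡ (pythagoras _) ⟩
      fromℕ 2 * 1#              ≈⟨ R.*-identityʳ _ ⟩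
      fromℕ 2 ∎
      where
      C = cos (π / 4)
      S = sin (π / 4)
      C²≈S² : C * C ≈ S * S
      C²≈S² = x-y≈0⇒x≈y (R.trans (R.sym (cos-+ _ _)) (R.trans (cos-cong π/4+π/4) cos-π/2))

    private
      C S G : Carrier
      C = cos (π / 6)
      S = sin (π / 6)
      G = C * C - S * S

      -- cos 3x = 0 reads G cos x = 2 sin² x cos x, where G = cos 2x.
      G≈2S² : G ≈ S * S + S * S
      G≈2S² = *-cancelˡ (cos-positive 6 π/6<π/2) (begin
        C * G                         ≈⟨ R.*-comm C G ⟩
        G * C                         ≈⟨ x-y≈0⇒x≈y triple ⟩
        (S * C + C * S) * S           ≈⟨ solve 2 (λ s c → (s :* c :+ c :* s) :* s := c :* (s :* s :+ s :* s)) R.refl S C ⟩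
        C * (S * S + S * S) ∎)
        where
        triple : G * C - (S * C + C * S) * S ≈ 0#
        triple = begin
          G * C - (S * C + C * S) * S
            ≈⟨ R.+-cong (R.*-congʳ (cos-+ _ _)) (R.-‿cong (R.*-congʳ (sin-+ _ _))) ⟨
          cos (π / 6 + π / 6) * C - sin (π / 6 + π / 6) * S ≈⟨ cos-+ _ _ ⟨
          cos (π / 6 + π / 6 + π / 6)                       ≈⟨ cos-cong π/6+π/6+π/6 ⟩
          cos (π / 2)                                       ≈⟨ cos-π/2 ⟩
          0# ∎

      C²≈3S² : C * C ≈ (S * S + S * S) + S * S
      C²≈3S² = -‿≈⇒≈+ G≈2S²

      4S²≈1 : (S * S + S * S + S * S) + S * S ≈ 1#
      4S²≈1 = R.trans (R.+-congʳ (R.sym C²≈3S²)) (pythagoras _)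

    -- The square is four times that of the cosine, hence twelve times that of the sine, and four of
    -- the latter add up to 1.
    λ₆² : λ[ 6 ] * λ[ 6 ] ≈ fromℕ 3
    λ₆² = begin
      λ[ 6 ] * λ[ 6 ]           ≈⟨ double-square C ⟩
      fromℕ 2 * (C * C + C * C) ≈⟨ R.*-congˡ (R.+-cong C²≈3S² C²≈3S²) ⟩
      fromℕ 2 * ((S * S + S * S + S * S) + (S * S + S * S + S * S))
        ≈⟨ R.trans (two-* _) (solve 1 (λ f →
             ((f :+ f :+ f) :+ (f :+ f :+ f)) :+ ((f :+ f :+ f) :+ (f :+ f :+ f)) :=
             ((f :+ f :+ f) :+ f) :+ ((f :+ f :+ f) :+ f) :+ ((f :+ f :+ f) :+ f)) R.refl (S * S)) ⟩
      q + q + q                 ≈⟨ three-* q ⟨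
      fromℕ 3 * q               ≈⟨ R.*-congˡ 4S²≈1 ⟩
      fromℕ 3 * 1#              ≈⟨ R.*-identityʳ _ ⟩
      fromℕ 3 ∎
      where
      q : Carrier
      q = (S * S + S * S + S * S) + S * S

    -- `G` is the cosine of `π / 3`, and twice `G` is four times the square of the sine of `π / 6`.
    λ₃ : λ[ 3 ] ≈ 1#
    λ₃ = begin
      fromℕ 2 * cos (π / 3)       ≈⟨ R.*-congˡ (cos-cong π/6+π/6) ⟨
      fromℕ 2 * cos (π / 6 + π / 6) ≈⟨ R.*-congˡ (R.trans (cos-+ _ _) G≈2S²) ⟩
      fromℕ 2 * (S * S + S * S)
        ≈⟨ R.trans (two-* _) (R.sym (R.+-assoc _ _ _)) ⟩
      (S * S + S * S + S * S) + S * S ≈⟨ 4S²≈1 ⟩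
      1# ∎

-- Friezes

parityℤ : ℤ → Parity
parityℤ i = parity ℤ.∣ i ∣

parity-⊖ : ∀ m n → parityℤ (m ℤ.⊖ n) ≡ parity m ℙ.+ parity n
parity-⊖ zero    zero    = refl
parity-⊖ zero    (suc n) = refl
parity-⊖ (suc m) zero    = ≡.sym (ℙ.+-identityʳ _)
parity-⊖ (suc m) (suc n) = begin
  parityℤ (suc m ℤ.⊖ suc n)             ≡⟨ cong parityℤ (ℤ.[1+m]⊖[1+n]≡m⊖n m n) ⟩
  parityℤ (m ℤ.⊖ n)                     ≡⟨ parity-⊖ m n ⟩
  parity m ℙ.+ parity n                 ≡⟨ flip-both (parity m) (parity n) ⟩
  parity m ⁻¹ ℙ.+ parity n ⁻¹           ≡⟨ ≡.cong₂ ℙ._+_ (parity-suc m) (parity-suc n) ⟨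
  parity (suc m) ℙ.+ parity (suc n) ∎
  where
  open ≡.≡-Reasoning
  flip-both : ∀ p q → p ℙ.+ q ≡ p ⁻¹ ℙ.+ q ⁻¹
  flip-both 0ℙ q = ≡.sym (ℙ.⁻¹-involutive q)
  flip-both 1ℙ q = refl

parityℤ-+ : ∀ i j → parityℤ (i ℤ.+ j) ≡ parityℤ i ℙ.+ parityℤ j
parityℤ-+ (+ m)    (+ n)    = ℙ.+-homo-+ m n
parityℤ-+ (+ m)    -[1+ n ] = parity-⊖ m (suc n)
parityℤ-+ -[1+ m ] (+ n)    = ≡.trans (parity-⊖ n (suc m)) (ℙ.+-comm (parity n) _)
parityℤ-+ -[1+ m ] -[1+ n ] =
  ≡.trans (cong (λ k → parity (suc k)) (≡.sym (ℕ.+-suc m n))) (ℙ.+-homo-+ (suc m) (suc n))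

parityℤ-* : ∀ i j → parityℤ (i ℤ.* j) ≡ parityℤ i ℙ.* parityℤ j
parityℤ-* i j = ≡.trans (cong parity (ℤ.abs-* i j)) (ℙ.*-homo-* ℤ.∣ i ∣ ℤ.∣ j ∣)

parityℤ-+1 : ∀ i → parityℤ (i ℤ.+ + 1) ≡ parityℤ i ⁻¹
parityℤ-+1 i = ≡.trans (parityℤ-+ i (+ 1)) (ℙ.+-comm (parityℤ i) 1ℙ)

parityℤ-odd : ∀ i {r} → parityℤ r ≡ 1ℙ → parityℤ (i ℤ.+ r) ≡ parityℤ i ⁻¹
parityℤ-odd i {r} r-odd = ≡.trans (parityℤ-+ i r)
  (≡.trans (cong (parityℤ i ℙ.+_) r-odd) (ℙ.+-comm (parityℤ i) 1ℙ))

isOdd⇒parityℤ : ∀ {r} → IsOdd r → parityℤ r ≡ 1ℙ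
isOdd⇒parityℤ (k , refl) = ≡.trans (parityℤ-+1 (+ 2 ℤ.* k)) (cong _⁻¹ (parityℤ-* (+ 2) k))

-- Reduction modulo an even number preserves parity. The alternating scaling of a frieze, indexed by
-- integers, thus agrees with the parity of the vertices.
parity-mod : ∀ i N .{{_ : NonZero N}} → parity N ≡ 0ℙ → parity (toℕ (i mod N)) ≡ parityℤ i
parity-mod i N N-even = begin
  parity (toℕ (i mod N))                            ≡⟨ cong parity (Fin.toℕ-fromℕ< (n%ℕd<d i N)) ⟩
  parity (i %ℕ N)                                   ≡⟨ ℙ.+-identityʳ _ ⟨
  parity (i %ℕ N) ℙ.+ 0ℙ                            ≡⟨ cong (parity (i %ℕ N) ℙ.+_) even-part ⟨
  parity (i %ℕ N) ℙ.+ parityℤ ((i /ℕ N) ℤ.* + N)     ≡⟨ parityℤ-+ (+ (i %ℕ N)) ((i /ℕ N) ℤ.* + N) ⟨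
  parityℤ (+ (i %ℕ N) ℤ.+ (i /ℕ N) ℤ.* + N)         ≡⟨ cong parityℤ (a≡a%ℕn+[a/ℕn]*n i N) ⟨
  parityℤ i ∎
  where
  open ≡.≡-Reasoning
  even-part : parityℤ ((i /ℕ N) ℤ.* + N) ≡ 0ℙ
  even-part = ≡.trans (parityℤ-* (i /ℕ N) (+ N))
    (≡.trans (cong (parityℤ (i /ℕ N) ℙ.*_) N-even) (ℙ.*-zeroʳ (parityℤ (i /ℕ N))))

+-mod : ∀ {i N} .{{_ : NonZero N}} (i<N : i ℕ.< N) → (+ i) mod N ≡ fromℕ< i<N
+-mod {i} {N} i<N = Fin.fromℕ<-cong _ _ (m<n⇒m%n≡m i<N) (n%ℕd<d (+ i) N) i<N

module FriezeProperties {c ℓ₁ ℓ₂} (ℝ : RealNumbers c ℓ₁ ℓ₂) (trig : Trigonometry ℝ) where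
  open RealNumbers ℝ
  open Trigonometry trig
  open Friezes ℝ trig
  open RealProperties ℝ
  open Angles trig
  open Algebra.Solver.Ring.NaturalCoefficients.Default R.commutativeSemiring
    using (solve; _:=_; _:*_)
  open Relation.Binary.Reasoning.Setoid R.setoid

  -- This is the unimodular rule for r = 0, in which the entry below the diagonal belongs to the row
  -- of ones.
  row₁ : ∀ {n m} → IsFrieze n m → ∀ i →
    m i i * m (i ℤ.+ + 1) (i ℤ.+ + 1) ≈ 1# + m i (i ℤ.+ + 1)
  row₁ {n} {m} F i = begin
    m i i * m j j                ≡⟨ cong (λ k → m i k * m j (k ℤ.+ + 1)) (ℤ.+-identityʳ i) ⟨
    m i (i ℤ.+ + 0) * m j (i ℤ.+ + 0 ℤ.+ + 1)
      ≈⟨ -‿≈⇒≈+ (unimodular i (+ 0) ℤ.-≤+ (ℤ.+≤+ ℕ.z≤n)) ⟩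
    1# + m j (i ℤ.+ + 0) * m i (i ℤ.+ + 0 ℤ.+ + 1)
      ≡⟨ cong (λ k → 1# + m j k * m i (k ℤ.+ + 1)) (ℤ.+-identityʳ i) ⟩
    1# + m j i * m i j           ≈⟨ R.+-congˡ (R.*-congʳ m-j-i) ⟩
    1# + 1# * m i j              ≈⟨ R.+-congˡ (R.*-identityˡ _) ⟩
    1# + m i j ∎
    where
    open IsFrieze F
    j : ℤ
    j = i ℤ.+ + 1
    j-1≡i : j ℤ.- + 1 ≡ i
    j-1≡i = ≡.trans (ℤ.+-assoc i (+ 1) (ℤ.- + 1)) (ℤ.+-identityʳ i)
    m-j-i : m j i ≈ 1#
    m-j-i = R.trans (R.reflexive (cong (m j) (≡.sym j-1≡i))) (row₋₁ j)

  -- Alternating scaling of a frieze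

  module Scaling (μ μ⁻¹ : Carrier) (μ-positive : 0# < μ) (μμ⁻¹≈1 : μ * μ⁻¹ ≈ 1#) where

    μ⁻¹μ≈1 : μ⁻¹ * μ ≈ 1#
    μ⁻¹μ≈1 = R.trans (R.*-comm μ⁻¹ μ) μμ⁻¹≈1

    μ⁻¹-positive : 0# < μ⁻¹
    μ⁻¹-positive = inverse-positive μ-positive μμ⁻¹≈1

    -- The continuant of c a₁, c⁻¹ a₂, c a₃, … is that of a₁, a₂, a₃, … times c, c⁻¹ or 1,
    -- according to the parities of its end points.
    factor : Parity → Parity → Parity → Carrier
    factor _  0ℙ 1ℙ = 1#
    factor _  1ℙ 0ℙ = 1#
    factor 0ℙ 0ℙ 0ℙ = μ
    factor 0ℙ 1ℙ 1ℙ = μ⁻¹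
    factor 1ℙ 0ℙ 0ℙ = μ⁻¹
    factor 1ℙ 1ℙ 1ℙ = μ

    factor-opposite : ∀ ε p → factor ε p (p ⁻¹) ≡ 1#
    factor-opposite ε 0ℙ = refl
    factor-opposite ε 1ℙ = refl

    factor-* : ∀ ε p q → factor ε p q * factor ε (p ⁻¹) (q ⁻¹) ≈ 1#
    factor-* _  0ℙ 1ℙ = R.*-identityˡ 1#
    factor-* _  1ℙ 0ℙ = R.*-identityˡ 1#
    factor-* 0ℙ 0ℙ 0ℙ = μμ⁻¹≈1
    factor-* 0ℙ 1ℙ 1ℙ = μ⁻¹μ≈1
    factor-* 1ℙ 0ℙ 0ℙ = μ⁻¹μ≈1
    factor-* 1ℙ 1ℙ 1ℙ = μμ⁻¹≈1

    factor-positive : ∀ ε p q → 0# < factor ε p q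
    factor-positive _  0ℙ 1ℙ = 0<1
    factor-positive _  1ℙ 0ℙ = 0<1
    factor-positive 0ℙ 0ℙ 0ℙ = μ-positive
    factor-positive 0ℙ 1ℙ 1ℙ = μ⁻¹-positive
    factor-positive 1ℙ 0ℙ 0ℙ = μ⁻¹-positive
    factor-positive 1ℙ 1ℙ 1ℙ = μ-positive

    -- With `μ` as `λ`, the scaled quiddity entry is q times this product: the scaling either
    -- completes `λ` to `λ²` or cancels it.
    factor-weight : ∀ {h} → μ * μ ≈ fromℕ h → ∀ ε p → μ * factor ε p p ≈ fromℕ (weight h ε p)
    factor-weight μ²≈h 0ℙ 0ℙ = μ²≈h
    factor-weight μ²≈h 0ℙ 1ℙ = R.trans μμ⁻¹≈1 (R.sym fromℕ-1)
    factor-weight μ²≈h 1ℙ 0ℙ = R.trans μμ⁻¹≈1 (R.sym fromℕ-1)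
    factor-weight μ²≈h 1ℙ 1ℙ = μ²≈h

    module _ (ε : Parity) where

      scale : Array → Array
      scale m i j = m i j * factor ε (parityℤ i) (parityℤ j)

      scale-opposite : ∀ m {i j} → parityℤ j ≡ parityℤ i ⁻¹ → scale m i j ≈ m i j
      scale-opposite m {i} {j} eq = begin
        m i j * factor ε (parityℤ i) (parityℤ j)     ≡⟨ cong (λ p → m i j * factor ε (parityℤ i) p) eq ⟩
        m i j * factor ε (parityℤ i) (parityℤ i ⁻¹)  ≡⟨ cong (m i j *_) (factor-opposite ε (parityℤ i)) ⟩
        m i j * 1#                                 ≈⟨ R.*-identityʳ _ ⟩
        m i j ∎

      -- Opposite corners of a two by two block differ in the parity of both indices, so their
      -- factors are inverse to each other and both products in the unimodular rule are unchanged.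
      scale-minor : ∀ m i j i′ j′ → parityℤ i′ ≡ parityℤ i ⁻¹ → parityℤ j′ ≡ parityℤ j ⁻¹ →
        scale m i j * scale m i′ j′ ≈ m i j * m i′ j′
      scale-minor m i j i′ j′ p q = begin
        (m i j * factor ε P Q) * (m i′ j′ * factor ε (parityℤ i′) (parityℤ j′))
          ≡⟨ ≡.cong₂ (λ p q → (m i j * factor ε P Q) * (m i′ j′ * factor ε p q)) p q ⟩
        (m i j * factor ε P Q) * (m i′ j′ * factor ε (P ⁻¹) (Q ⁻¹))
          ≈⟨ solve 4 (λ a f b g → (a :* f) :* (b :* g) := (a :* b) :* (f :* g)) R.refl
               (m i j) (factor ε P Q) (m i′ j′) (factor ε (P ⁻¹) (Q ⁻¹)) ⟩
        (m i j * m i′ j′) * (factor ε P Q * factor ε (P ⁻¹) (Q ⁻¹))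
          ≈⟨ R.*-congˡ (factor-* ε P Q) ⟩
        (m i j * m i′ j′) * 1# ≈⟨ R.*-identityʳ _ ⟩
        m i j * m i′ j′ ∎
        where
        P Q : Parity
        P = parityℤ i
        Q = parityℤ j

      -- Odd rows are left alone by the scaling. As `n` is odd, this covers both rows of ones; the
      -- rows of zeros stay zero under any factor.
      scale-frieze : ∀ {n m} → parity n ≡ 1ℙ → IsFrieze n m → IsFrieze n (scale m)
      scale-frieze {n} {m} n-odd F = record
        { row₋₂      = λ i → zero-entry (row₋₂ i)
        ; row₋₁      = λ i → R.trans (scale-opposite m (parityℤ-odd i refl)) (row₋₁ i)
        ; rowₙ       = λ i → R.trans (scale-opposite m (parityℤ-odd i n-odd)) (rowₙ i)
        ; rowₙ₊₁     = λ i → zero-entry (rowₙ₊₁ i)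
        ; positive   = λ i r 0≤r r<n → *-positive (positive i r 0≤r r<n) (factor-positive ε (parityℤ i) (parityℤ (i ℤ.+ r)))
        ; unimodular = λ i r -1≤r r≤n → R.trans
            (R.+-cong
              (scale-minor m i (i ℤ.+ r) (i ℤ.+ + 1) (i ℤ.+ r ℤ.+ + 1) (parityℤ-+1 i) (parityℤ-+1 (i ℤ.+ r)))
              (R.-‿cong (scale-minor m (i ℤ.+ + 1) (i ℤ.+ r) i (i ℤ.+ r ℤ.+ + 1)
                (≡.sym (≡.trans (cong _⁻¹ (parityℤ-+1 i)) (ℙ.⁻¹-involutive _))) (parityℤ-+1 (i ℤ.+ r)))))
            (unimodular i r -1≤r r≤n)
        }
        where
        open IsFrieze F
        zero-entry : ∀ {x y} → x ≈ 0# → x * y ≈ 0#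
        zero-entry {x} {y} x≈0 = R.trans (R.*-congʳ x≈0) (R.zeroˡ y)

  -- The triangulations that coincide with the frieze of an angulation

  module _ {h k n} .{{_ : NonZero k}} (h-prime : Prime h) (4≤k : 4 ℕ.≤ k)
    (refinable : ∀ {a b} (t : Tree a b) → Uniform k t → Refinable h t)
    (λ-positive′ : 0# < λ[ k ]) (λ² : λ[ k ] * λ[ k ] ≈ fromℕ h)
    (D : Angulation k (3 ℕ.+ n)) where

    open Refinement h-prime 4≤k refinable D

    private
      module S = Scaling λ[ k ] (proj₁ (positive⇒invertible λ-positive′)) λ-positive′
                   (proj₂ (positive⇒invertible λ-positive′))

      q : Fin (3 ℕ.+ n) → ℕ
      q = incidence (dissection D)

      N-even : parity (3 ℕ.+ n) ≡ 0ℙ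
      N-even = ≡.trans (parity-suc (2 ℕ.+ n)) (cong _⁻¹ parity-2+n)

    module _ {m} (F : IsFriezeOf D m) where
      open IsFriezeOf F

      refinement-quiddity : ∀ ε i → S.scale ε m i i ≈
        λ[ 3 ] * fromℕ (incidence (dissection (refinement ε)) (i mod (3 ℕ.+ n)))
      refinement-quiddity ε i = begin
        m i i * f                                 ≈⟨ R.*-congʳ (quiddity i) ⟩
        (λ[ k ] * fromℕ (q α)) * f                ≈⟨ solve 3 (λ a b c → (a :* b) :* c := (a :* c) :* b) R.refl λ[ k ] (fromℕ (q α)) f ⟩
        (λ[ k ] * f) * fromℕ (q α)                ≈⟨ R.*-congʳ (S.factor-weight λ² ε (parityℤ i)) ⟩
        fromℕ (weight h ε (parityℤ i)) * fromℕ (q α)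
          ≡⟨ cong (λ p → fromℕ (weight h ε p) * fromℕ (q α)) (parity-mod i (3 ℕ.+ n) N-even) ⟨
        fromℕ (weight h ε (parity (toℕ α))) * fromℕ (q α) ≈⟨ fromℕ-* (weight h ε (parity (toℕ α))) (q α) ⟨
        fromℕ (weight h ε (parity (toℕ α)) ℕ.* q α)       ≡⟨ cong fromℕ (refinement-incidence ε α) ⟨
        fromℕ (incidence (dissection (refinement ε)) α)   ≈⟨ R.*-identityˡ (fromℕ (incidence (dissection (refinement ε)) α)) ⟨
        1# * fromℕ (incidence (dissection (refinement ε)) α) ≈⟨ R.*-congʳ λ₃ ⟨
        λ[ 3 ] * fromℕ (incidence (dissection (refinement ε)) α) ∎
        where
        α : Fin (3 ℕ.+ n)
        α = i mod (3 ℕ.+ n)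
        f : Carrier
        f = S.factor ε (parityℤ i) (parityℤ i)

      refinement-coincides : ∀ ε → CoincidesWithConwayCoxeter m (refinement ε)
      refinement-coincides ε = S.scale ε m ,
        record { isFrieze = S.scale-frieze ε parity-2+n isFrieze ; quiddity = refinement-quiddity ε } ,
        λ i r r-odd _ _ → R.sym (S.scale-opposite ε m (parityℤ-odd i (isOdd⇒parityℤ r-odd)))

      coinciding-products : ∀ T → CoincidesWithConwayCoxeter m T → ∀ i →
        let α = i mod (3 ℕ.+ n); β = (i ℤ.+ + 1) mod (3 ℕ.+ n) in
        incidence (dissection T) α ℕ.* incidence (dissection T) β ≡ h ℕ.* (q α ℕ.* q β)
      coinciding-products T (m′ , F′ , coincide) i = fromℕ-injective
        {incidence (dissection T) α ℕ.* incidence (dissection T) β} {h ℕ.* (q α ℕ.* q β)} (begin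
        fromℕ (incidence (dissection T) α ℕ.* incidence (dissection T) β) 
          ≈⟨ fromℕ-* (incidence (dissection T) α) (incidence (dissection T) β) ⟩
        fromℕ (incidence (dissection T) α) * fromℕ (incidence (dissection T) β)
          ≈⟨ R.*-cong (quiddity′ i) (quiddity′ j) ⟨
        m′ i i * m′ j j                   ≈⟨ row₁ (IsFriezeOf.isFrieze F′) i ⟩
        -- Row 1 is one of the shared rows: 1 is 2 times 0 plus 1, and it is at most n + 1.
        1# + m′ i j                       ≈⟨ R.+-congˡ (coincide i (+ 1) (+ 0 , refl) ℤ.-≤+ (ℤ.+≤+ (ℕ.m≤n+m 1 n))) ⟨
        1# + m i j                        ≈⟨ row₁ isFrieze i ⟨
        m i i * m j j                     ≈⟨ R.*-cong (quiddity i) (quiddity j) ⟩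
        (λ[ k ] * fromℕ (q α)) * (λ[ k ] * fromℕ (q β))
          ≈⟨ solve 3 (λ l a b → (l :* a) :* (l :* b) := (l :* l) :* (a :* b)) R.refl λ[ k ] (fromℕ (q α)) (fromℕ (q β)) ⟩
        (λ[ k ] * λ[ k ]) * (fromℕ (q α) * fromℕ (q β)) ≈⟨ R.*-cong λ² (R.sym (fromℕ-* (q α) (q β))) ⟩
        fromℕ h * fromℕ (q α ℕ.* q β)     ≈⟨ fromℕ-* h (q α ℕ.* q β) ⟨
        fromℕ (h ℕ.* (q α ℕ.* q β)) ∎)
        where
        j : ℤ
        j = i ℤ.+ + 1
        α β : Fin (3 ℕ.+ n)
        α = i mod (3 ℕ.+ n)
        β = j mod (3 ℕ.+ n)
        quiddity′ : ∀ i → m′ i i ≈ fromℕ (incidence (dissection T) (i mod (3 ℕ.+ n)))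
        quiddity′ i = R.trans (IsFriezeOf.quiddity F′ i) (R.trans (R.*-congʳ λ₃) (R.*-identityˡ _))

      coinciding-unique : ∀ T → CoincidesWithConwayCoxeter m T →
        ∃ λ ε → dissection T ≐ dissection (refinement ε)
      coinciding-unique T coincides = refinement-unique T λ i i<2+n →
        ≡.subst₂ (λ α β → incidence (dissection T) α ℕ.* incidence (dissection T) β ≡ h ℕ.* (q α ℕ.* q β))
          (+-mod (ℕ.m<n⇒m<1+n i<2+n))
          (≡.trans (cong (λ j → (+ j) mod (3 ℕ.+ n)) (ℕ.+-comm i 1)) (+-mod (ℕ.s≤s i<2+n)))
          (coinciding-products T coincides (+ i))

    -- Both triangulations are built from `D` alone, so they can be named before the frieze `m`.
    exactly-two : ∃₂ λ (T° T• : Triangulation (3 ℕ.+ n)) →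
      ¬ (dissection T° ≐ dissection T•) ×
      (∀ m → IsFriezeOf D m →
        CoincidesWithConwayCoxeter m T° ×
        CoincidesWithConwayCoxeter m T• ×
        (∀ T → CoincidesWithConwayCoxeter m T →
          (dissection T ≐ dissection T°) ⊎ (dissection T ≐ dissection T•)))
    exactly-two = refinement 0ℙ , refinement 1ℙ , refinement-distinct , λ m F →
      refinement-coincides F 0ℙ , refinement-coincides F 1ℙ ,
      λ T coincides → either {T} (coinciding-unique F T coincides)
      where
      either : ∀ {T} → (∃ λ ε → dissection T ≐ dissection (refinement ε)) →
        (dissection T ≐ dissection (refinement 0ℙ)) ⊎ (dissection T ≐ dissection (refinement 1ℙ))
      either (0ℙ , eq) = inj₁ eq
      either (1ℙ , eq) = inj₂ eq

open import Data.Nat.Base using (_+_)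

theorem7 : ∀ {c ℓ₁ ℓ₂} (ℝ : RealNumbers c ℓ₁ ℓ₂) (trig : Trigonometry ℝ) →
    let open Friezes ℝ trig in
    ∀ (p : ℕ) .{{_ : NonZero p}} → p ≡ 4 ⊎ p ≡ 6 →
    ∀ (n : ℕ) (D : Angulation p (3 + n)) →
    ∃₂ λ (T° T• : Triangulation (3 + n)) →
    ¬ (dissection T° ≐ dissection T•) ×
    (∀ m → IsFriezeOf D m →
    CoincidesWithConwayCoxeter m T° ×
    CoincidesWithConwayCoxeter m T• ×
    (∀ T → CoincidesWithConwayCoxeter m T →
    (dissection T ≐ dissection T°) ⊎ (dissection T ≐ dissection T•)))
theorem7 ℝ trig _ (inj₁ refl) n D =
  exactly-two (from-yes (prime? 2)) ℕ.≤-refl quad-refinable λ₄-positive λ₄² D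
  where
  open FriezeProperties ℝ trig
  open RealProperties.Angles ℝ trig
theorem7 ℝ trig _ (inj₂ refl) n D =
  exactly-two (from-yes (prime? 3)) (ℕ.m≤n+m 4 2) hex-refinable λ₆-positive λ₆² D
  where
  open FriezeProperties ℝ trig
  open RealProperties.Angles ℝ trig
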